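{- (a) Let $G$ be a line graph and let $t\leq 4$ be a positive integer. Then $G$ has a $K_t$-immersion if and only if $G$ has a $K_t$-minor. (b) For every integer $t\geq 5$ there exists a line graph that has a $K_t$-immersion but no $K_t$-minor, and there exists a line graph that has a $K_t$-minor but no $K_t$-immersion.
   Context: Graphs are finite and may have parallel edges but no loops. A line graph is a graph of the form $L(H)$ for some graph $H$ (possibly with parallel edges), where $L(H)$ is the simple graph with vertex set $E(H)$ in which two distinct edges of $H$ are adjacent iff they share at least one endpoint. A graph $G$ has a $K_t$-immersion if there is an injective map $\phi$ from the vertex set of $K_t$ to $V(G)$ and, for each pair $u\neq v$ of vertices of $K_t$, a path in $G$ joining $\phi(u)$ and $\phi(v)$, such that these paths are pairwise edge-disjoint. $G$ has a $K_t$-minor if $K_t$ can be obtained from a subgraph of $G$ by contracting edges. -}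

module Defs where

open import Data.Nat using (ℕ)
open import Data.Fin using (Fin; _<_)
open import Data.Fin.Properties using (_≟_; _<?_; any?; <⇒≢)
open import Data.Product using (∃-syntax; _×_; _,_; proj₁; proj₂)
open import Data.Sum using (_⊎_)
open import Data.List using (List; []; _∷_; length; lookup; filter; cartesianProduct; allFin)
open import Data.List.Membership.Propositional.Properties using (∈-lookup; ∈-filter⁻)
open import Data.List.Relation.Unary.Unique.Propositional using (Unique)
open import Data.List.Relation.Binary.Disjoint.Propositional using (Disjoint)
open import Function using (_⇔_; _↔_; Injective; Surjective; Inverse)
open import Level using (0ℓ)
open import Relation.Binary using (Rel; Decidable)
open import Relation.Binary.Construct.Closure.ReflexiveTransitive using (Star)
open import Relation.Binary.PropositionalEquality using (_≡_; _≢_)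
open import Relation.Nullary.Decidable using (_×-dec_; _⊎-dec_; ¬?)
import Relation.Unary as U

-- The order in which `ends` lists the two endpoints carries no meaning.
record Graph : Set where
  field
    #V #E    : ℕ
    ends     : Fin #E → Fin #V × Fin #V
    loopless : ∀ e → proj₁ (ends e) ≢ proj₂ (ends e)

  V : Set
  V = Fin #V

  E : Set
  E = Fin #E

  Joins : E → V → V → Set
  Joins e x y = ends e ≡ (x , y) ⊎ ends e ≡ (y , x)

  Endpoint : E → V → Set
  Endpoint e x = proj₁ (ends e) ≡ x ⊎ proj₂ (ends e) ≡ x

  ShareEndpoint : Rel E 0ℓ
  ShareEndpoint e f = ∃[ x ] (Endpoint e x × Endpoint f x)

  endpoint? : Decidable Endpoint
  endpoint? e x = (proj₁ (ends e) ≟ x) ⊎-dec (proj₂ (ends e) ≟ x)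

  shareEndpoint? : Decidable ShareEndpoint
  shareEndpoint? e f = any? λ x → endpoint? e x ×-dec endpoint? f x

open Graph public using (V; E; Joins)

-- The simple graph on Fin n with exactly one edge for each pair i < j with
-- R i j.  It is only used for symmetric R.
module _ {n : ℕ} {R : Rel (Fin n) 0ℓ} (R? : Decidable R) where

  OrderedEdge : U.Pred (Fin n × Fin n) 0ℓ
  OrderedEdge (i , j) = i < j × R i j

  orderedEdge? : U.Decidable OrderedEdge
  orderedEdge? (i , j) = (i <? j) ×-dec R? i j

  allPairs edgeList : List (Fin n × Fin n)
  allPairs = cartesianProduct (allFin n) (allFin n)
  edgeList = filter orderedEdge? allPairs

  simpleGraph : Graph
  simpleGraph = record
    { #V       = n
    ; #E       = length edgeList
    ; ends     = lookup edgeList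
    ; loopless = λ e → <⇒≢ (proj₁ (proj₂
        (∈-filter⁻ orderedEdge? {xs = allPairs} (∈-lookup {xs = edgeList} e))))
    }

K : ℕ → Graph
K t = simpleGraph {t} (λ i j → ¬? (i ≟ j))

L : Graph → Graph
L H = simpleGraph (Graph.shareEndpoint? H)

infix 4 _≅_ _≲_

record _≅_ (G H : Graph) : Set where
  field
    onV   : V G ↔ V H
    onE   : E G ↔ E H
    joins : ∀ {e x y} → Joins G e x y →
            Joins H (Inverse.to onE e) (Inverse.to onV x) (Inverse.to onV y)

IsLineGraph : Graph → Set
IsLineGraph G = ∃[ H ] G ≅ L H

-- S ≲ G: S is, up to renaming of vertices and edges, a subgraph of G.
record _≲_ (S G : Graph) : Set where
  field
    onV    : V S → V G
    onE    : E S → E G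
    onVInj : Injective _≡_ _≡_ onV
    onEInj : Injective _≡_ _≡_ onE
    joins  : ∀ {e x y} → Joins S e x y → Joins G (onE e) (onV x) (onV y)

module _ (G : Graph) where

  data Walk : V G → V G → Set where
    nil  : ∀ {x} → Walk x x
    cons : ∀ {x y z} (e : E G) → Joins G e x y → Walk y z → Walk x z

module _ {G : Graph} where

  vertices : ∀ {x y} → Walk G x y → List (V G)
  vertices {x} nil          = x ∷ []
  vertices {x} (cons _ _ w) = x ∷ vertices w

  edges : ∀ {x y} → Walk G x y → List (E G)
  edges nil          = []
  edges (cons e _ w) = e ∷ edges w

record Path (G : Graph) (x y : V G) : Set where
  field
    walk   : Walk G x y
    simple : Unique (vertices walk)

EdgeDisjoint : ∀ {G x y x′ y′} → Path G x y → Path G x′ y′ → Set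
EdgeDisjoint p q = Disjoint (edges (Path.walk p)) (edges (Path.walk q))

-- One path per unordered pair of vertices of K t, represented by u < v.
record KImmersion (t : ℕ) (G : Graph) : Set where
  field
    φ        : Fin t → V G
    φInj     : Injective _≡_ _≡_ φ
    path     : ∀ u v → u < v → Path G (φ u) (φ v)
    disjoint : ∀ {u v u′ v′} (u<v : u < v) (u′<v′ : u′ < v′) →
               (u , v) ≢ (u′ , v′) →
               EdgeDisjoint (path u v u<v) (path u′ v′ u′<v′)

-- G′ is, up to renaming, G / e: the two ends of e are identified, e and all
-- edges parallel to it (which would become loops) disappear, and every other
-- edge survives (so parallel edges may arise).  The map `from` sends an edge
-- of G′ to the edge of G it comes from.
record Contraction (G : Graph) (e : E G) (G′ : Graph) : Set where
  field
    π        : V G → V G′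
    πSurj    : Surjective _≡_ _≡_ π
    fibres   : ∀ x y → π x ≡ π y ⇔ (x ≡ y ⊎ Joins G e x y)
    from     : E G′ → E G
    fromInj  : Injective _≡_ _≡_ from
    joins    : ∀ {f x y} → Joins G (from f) x y → Joins G′ f (π x) (π y)
    survives : ∀ {f x y} → Joins G f x y → π x ≢ π y → ∃[ f′ ] from f′ ≡ f

ContractEdge : Rel Graph 0ℓ
ContractEdge G G′ = ∃[ e ] Contraction G e G′

KMinor : ℕ → Graph → Set
KMinor t G = ∃[ S ] ∃[ M ] (S ≲ G × Star ContractEdge S M × M ≅ K t)

{-# OPTIONS --safe #-}
-- Minors are handled through bag models: disjoint connected vertex sets, one
-- for each vertex of K_t, that are pairwise adjacent.
--
-- (a) For t ≤ 4 at most three terminals have to be linked inside each bag, so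
-- in any graph a K_t-model contains a subdivision of K_t.  Conversely, let
-- L(H) have a K₄-immersion.  If H has a vertex of degree at least 4, then L(H)
-- contains K₄.  Otherwise a 2-colouring of E(H) whose bichromatic incidences
-- all occur at one vertex is crossed by at most two edges of L(H), so it
-- cannot separate two branch vertices.  Hence a branch vertex e₁ is not a
-- bridge of H but lies on a cycle.  A path of H joining two vertices of the
-- cycle outside of it gives three edge-disjoint walks between two vertices and
-- thus a K₄-model of L(H).  If there is no such path, then what hangs off each
-- vertex of the cycle is cut off by a colouring as above, so all four branch
-- vertices are edges of the cycle.  They divide it into four arcs, which two
-- of the six paths at most can traverse, and this is too little.
--
-- (b) For L(H) with H obtained from K₄ by making one edge parallel t - 4
-- times, a path through one vertex supplies the adjacencies missing from K_t
-- among the others; but there are only t + 1 vertices, and three disjoint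
-- non-adjacent pairs exclude a K_t-minor.  Conversely a K_t-minor is found in
-- the line graph of a subdivided subcubic graph; it has maximum degree 3 and
-- thus no K₅-immersion.
module Submission where

open import Data.Bool using (Bool; true; false; _∧_)
import Data.Bool.Properties as Boolₚ
open import Data.Empty using (⊥; ⊥-elim)
open import Data.Fin as Fin using (Fin; zero; suc; _<_; inject₁; combine; remQuot; punchIn; punchOut; toℕ)
open import Data.Fin.Induction using (<-weakInduction)
open import Data.Fin.Patterns using (0F; 1F; 2F; 3F; 4F; 5F)
import Data.Fin.Properties as Finₚ
open import Data.Fin.Properties using (_≟_; _≤?_; <⇒≢; <-cmp; <-asym; <-irrelevant; ≤-antisym; ≤-total; any?; all?; injective⇒≤; pigeonhole; inject₁-injective; combine-remQuot; remQuot-combine; punchIn-punchOut; punchOut-injective)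
open import Data.List using (List; []; _∷_; _++_; length; lookup; filter; allFin)
import Data.List.Membership.DecPropositional as DecMembership
open import Data.List.Membership.Propositional using (_∈_; _∉_)
open import Data.List.Membership.Propositional.Properties using (∈-lookup; ∈-filter⁺; ∈-filter⁻; ∈-allFin; ∈-cartesianProduct⁺; ∈-++⁺ˡ; ∈-++⁺ʳ; ∈-++⁻)
open import Data.List.Properties using (++-assoc)
open import Data.List.Relation.Binary.Disjoint.Propositional using (Disjoint)
open import Data.List.Relation.Binary.Subset.Propositional using (_⊆_)
import Data.List.Relation.Unary.All as All
open import Data.List.Relation.Unary.All using (All; []; _∷_)
import Data.List.Relation.Unary.All.Properties as Allₚ
open import Data.List.Relation.Unary.AllPairs using (AllPairs; []; _∷_; allPairs?)
import Data.List.Relation.Unary.Any as Any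
open import Data.List.Relation.Unary.Any using (here; there; index)
open import Data.List.Relation.Unary.Any.Properties using (lookup-index)
open import Data.List.Relation.Unary.Unique.Propositional using (Unique)
open import Data.List.Relation.Unary.Unique.Propositional.Properties using (allFin⁺; cartesianProduct⁺; filter⁺; ++⁺)
open import Data.Nat as ℕ using (ℕ; zero; suc; _≤_; s≤s; z≤n)
import Data.Nat.Properties as ℕₚ
open import Data.Product using (Σ; ∃; ∃₂; ∃-syntax; _×_; _,_; proj₁; proj₂)
open import Data.Product.Properties using (,-injective)
import Data.Sum as Sum
open import Data.Sum using (_⊎_; inj₁; inj₂; [_,_])
open import Function using (_∘_; id; Injective; _⇔_; mk⇔; mk↔ₛ′; Inverse; Equivalence; _∋_)
open import Function.Construct.Identity using (↔-id)
open import Level using (0ℓ)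
open import Relation.Binary using (Rel; Decidable; Symmetric; Tri; tri<; tri≈; tri>)
import Relation.Binary.Construct.Closure.ReflexiveTransitive as Star
open import Relation.Binary.Construct.Closure.ReflexiveTransitive using (Star; ε; _◅_; _◅◅_)
open import Relation.Binary.PropositionalEquality using (_≡_; _≢_; refl; sym; trans; cong; cong₂; subst; subst₂; ≢-sym)
open import Relation.Nullary using (¬_; Dec; yes; no; contradiction; does)
open import Relation.Nullary.Decidable using (_×-dec_; _⊎-dec_; _→-dec_; ¬?; from-yes; False; toWitnessFalse; dec-true; dec-false; decidable-stable)
import Relation.Unary as U
open import Defs

-- Why degree 3 matters: the edges of H at such a vertex span only a triangle of L(H), and a
-- 2-colouring of a triangle has at most two bichromatic edges, whereas two branch vertices of a
-- K₄-immersion are separated only by crossing three edge-disjoint paths. Hence colourings of E(H)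
-- are the cuts to look for. The obstacle is that immersion paths may share vertices with each other
-- and leave the cycle and return, so they cannot be followed. They are therefore forgotten, and
-- only the fact that they cross every separating colouring is kept. What makes t = 5 different in
-- the other direction is that four terminals in a tree with two vertices of degree 3 have no common
-- centre with edge-disjoint legs. In the second example of (b) the subdivision gives each edge of H
-- one end of degree at most 2, so that its degree in L(H) is at most 2 + 1, while a branch vertex
-- of a K₅-immersion has degree at least 4.

-- Enumerations of decidable subsets

lookup-injective : {A : Set} {xs : List A} → Unique xs → Injective _≡_ _≡_ (lookup xs)
lookup-injective (_ ∷ _)  {zero}  {zero}  _  = refl
lookup-injective {xs = _ ∷ xs} (x∉ ∷ _) {zero}  {suc j} eq = contradiction eq (All.lookup x∉ (∈-lookup {xs = xs} j))
lookup-injective {xs = _ ∷ xs} (x∉ ∷ _) {suc i} {zero}  eq = contradiction (sym eq) (All.lookup x∉ (∈-lookup {xs = xs} i))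
lookup-injective (_ ∷ u)  {suc i} {suc j} eq = cong suc (lookup-injective u eq)

-- Vertices and edges of a graph are numbered without gaps, so subgraphs and quotients are built on
-- renumbered decidable subsets.
record Enumeration {n : ℕ} (P : Fin n → Set) : Set where
  field
    size      : ℕ
    elt       : Fin size → Fin n
    injective : Injective _≡_ _≡_ elt
    satisfies : ∀ k → P (elt k)
    indexOf   : ∀ {x} → P x → Fin size
    elt-index : ∀ {x} (p : P x) → elt (indexOf p) ≡ x

abstract
  enumerate : ∀ {n} {P : Fin n → Set} → U.Decidable P → Enumeration P
  enumerate {n} {P} P? = record
    { size      = length xs
    ; elt       = lookup xs
    ; injective = lookup-injective (filter⁺ P? (allFin⁺ n))
    ; satisfies = λ k → proj₂ (∈-filter⁻ P? {xs = allFin n} (∈-lookup {xs = xs} k))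
    ; indexOf   = λ p → index (listed p)
    ; elt-index = λ p → sym (lookup-index (listed p))
    }
    where
    xs : List (Fin n)
    xs = filter P? (allFin n)
    listed : ∀ {x} → P x → x ∈ xs
    listed {x} p = ∈-filter⁺ P? (∈-allFin x) p

-- Adjacency and walks

Adj : (G : Graph) → Rel (V G) 0ℓ
Adj G x y = ∃[ e ] Joins G e x y

module _ (G : Graph) where
  open Graph G using (Endpoint; ends; loopless)

  joins-sym : ∀ {e x y} → Joins G e x y → Joins G e y x
  joins-sym = Sum.swap

  adj-sym : ∀ {x y} → Adj G x y → Adj G y x
  adj-sym (e , j) = e , joins-sym {e} j

  joins-ends : ∀ e → Joins G e (proj₁ (ends e)) (proj₂ (ends e))
  joins-ends e = inj₁ refl

  joins-unique : ∀ {e x y x′ y′} → Joins G e x y → Joins G e x′ y′ →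
                 (x ≡ x′ × y ≡ y′) ⊎ (x ≡ y′ × y ≡ x′)
  joins-unique (inj₁ p) (inj₁ q) = inj₁ (,-injective (trans (sym p) q))
  joins-unique (inj₁ p) (inj₂ q) = inj₂ (,-injective (trans (sym p) q))
  joins-unique (inj₂ p) (inj₁ q) = let a , b = ,-injective (trans (sym p) q) in inj₂ (b , a)
  joins-unique (inj₂ p) (inj₂ q) = let a , b = ,-injective (trans (sym p) q) in inj₁ (b , a)

  joins-≢ : ∀ {e x y} → Joins G e x y → x ≢ y
  joins-≢ {e} (inj₁ p) refl = loopless e (trans (cong proj₁ p) (sym (cong proj₂ p)))
  joins-≢ {e} (inj₂ p) refl = loopless e (trans (cong proj₁ p) (sym (cong proj₂ p)))

  joins⇒endpointˡ : ∀ {e x y} → Joins G e x y → Endpoint e x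
  joins⇒endpointˡ (inj₁ p) = inj₁ (cong proj₁ p)
  joins⇒endpointˡ (inj₂ p) = inj₂ (cong proj₂ p)

  joins⇒endpointʳ : ∀ {e x y} → Joins G e x y → Endpoint e y
  joins⇒endpointʳ {e} j = joins⇒endpointˡ (joins-sym {e} j)

  endpoint-cases : ∀ {e x y w} → Joins G e x y → Endpoint e w → w ≡ x ⊎ w ≡ y
  endpoint-cases (inj₁ p) (inj₁ q) = inj₁ (trans (sym q) (cong proj₁ p))
  endpoint-cases (inj₁ p) (inj₂ q) = inj₂ (trans (sym q) (cong proj₂ p))
  endpoint-cases (inj₂ p) (inj₁ q) = inj₂ (trans (sym q) (cong proj₁ p))
  endpoint-cases (inj₂ p) (inj₂ q) = inj₁ (trans (sym q) (cong proj₂ p))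

Simple : Graph → Set
Simple G = ∀ {e f x y} → Joins G e x y → Joins G f x y → e ≡ f

module _ {n : ℕ} {R : Rel (Fin n) 0ℓ} (R? : Decidable R) where
  private
    G = simpleGraph R?
    pairs = edgeList R?

    listed : ∀ e → lookup pairs e ∈ pairs
    listed e = ∈-lookup {xs = pairs} e

  simpleGraph-ordered : ∀ e → OrderedEdge R? (Graph.ends G e)
  simpleGraph-ordered e = proj₂ (∈-filter⁻ (orderedEdge? R?) {xs = allPairs R?} (listed e))

  ends-injective : Injective _≡_ _≡_ (Graph.ends G)
  ends-injective = lookup-injective (filter⁺ (orderedEdge? R?) (cartesianProduct⁺ (allFin⁺ n) (allFin⁺ n)))

  simpleGraph-simple : Simple G
  simpleGraph-simple (inj₁ p) (inj₁ q) = ends-injective (trans p (sym q))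
  simpleGraph-simple (inj₂ p) (inj₂ q) = ends-injective (trans p (sym q))
  simpleGraph-simple {e} {f} (inj₁ p) (inj₂ q) =
    contradiction (subst (OrderedEdge R?) q (simpleGraph-ordered f) .proj₁)
                  (<-asym (subst (OrderedEdge R?) p (simpleGraph-ordered e) .proj₁))
  simpleGraph-simple {e} {f} (inj₂ p) (inj₁ q) =
    contradiction (subst (OrderedEdge R?) q (simpleGraph-ordered f) .proj₁)
                  (<-asym (subst (OrderedEdge R?) p (simpleGraph-ordered e) .proj₁))

  simpleGraph-edge< : ∀ {x y} → x < y → R x y → ∃[ e ] Graph.ends G e ≡ (x , y)
  simpleGraph-edge< {x} {y} x<y r = index m , sym (lookup-index m)
    where
    m : (x , y) ∈ pairs
    m = ∈-filter⁺ (orderedEdge? R?) (∈-cartesianProduct⁺ (∈-allFin x) (∈-allFin y)) (x<y , r)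

  module _ (R-sym : Symmetric R) where

    simpleGraph-related : ∀ {e x y} → Joins G e x y → R x y
    simpleGraph-related {e} (inj₁ p) = subst (OrderedEdge R?) p (simpleGraph-ordered e) .proj₂
    simpleGraph-related {e} (inj₂ p) = R-sym (subst (OrderedEdge R?) p (simpleGraph-ordered e) .proj₂)

    simpleGraph-adj : ∀ {x y} → x ≢ y → R x y → Adj G x y
    simpleGraph-adj {x} {y} x≢y r with <-cmp x y
    ... | tri< x<y _ _ = let e , eq = simpleGraph-edge< x<y r in e , inj₁ eq
    ... | tri≈ _ x≡y _ = contradiction x≡y x≢y
    ... | tri> _ _ y<x = let e , eq = simpleGraph-edge< y<x (R-sym r) in e , inj₂ eq

share-sym : (H : Graph) → Symmetric (Graph.ShareEndpoint H)
share-sym H (x , p , q) = x , q , p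

module _ {G : Graph} where
  open Graph G using (Endpoint)

  infixr 5 _⟫_
  _⟫_ : ∀ {x y z} → Walk G x y → Walk G y z → Walk G x z
  nil        ⟫ q = q
  cons e j p ⟫ q = cons e j (p ⟫ q)

  edges-⟫ : ∀ {x y z} (p : Walk G x y) (q : Walk G y z) → edges (p ⟫ q) ≡ edges p ++ edges q
  edges-⟫ nil          q = refl
  edges-⟫ (cons e _ p) q = cong (e ∷_) (edges-⟫ p q)

  ∈-⟫⁻ : ∀ {x y z e} (p : Walk G x y) (q : Walk G y z) → e ∈ edges (p ⟫ q) → e ∈ edges p ⊎ e ∈ edges q
  ∈-⟫⁻ p q m = ∈-++⁻ (edges p) (subst (_ ∈_) (edges-⟫ p q) m)

  rev : ∀ {x y} → Walk G x y → Walk G y x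
  rev nil          = nil
  rev (cons e j p) = rev p ⟫ cons e (joins-sym G {e} j) nil

  ∈-rev⁻ : ∀ {x y e} (p : Walk G x y) → e ∈ edges (rev p) → e ∈ edges p
  ∈-rev⁻ (cons e j p) m with ∈-⟫⁻ (rev p) _ m
  ... | inj₁ m′          = there (∈-rev⁻ p m′)
  ... | inj₂ (here refl) = here refl

  start-∈ : ∀ {x y} (p : Walk G x y) → x ∈ vertices p
  start-∈ nil          = here refl
  start-∈ (cons _ _ _) = here refl

  end-∈ : ∀ {x y} (p : Walk G x y) → y ∈ vertices p
  end-∈ nil          = here refl
  end-∈ (cons _ _ p) = there (end-∈ p)

  endpoint-∈ : ∀ {x y e w} (p : Walk G x y) → e ∈ edges p → Endpoint e w → w ∈ vertices p
  endpoint-∈ (cons e j p) (here refl) w∈e with endpoint-cases G {e} j w∈e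
  ... | inj₁ refl = here refl
  ... | inj₂ refl = there (start-∈ p)
  endpoint-∈ (cons _ _ p) (there m) w∈e = there (endpoint-∈ p m w∈e)

  simple⇒unique-edges : ∀ {x y} (p : Walk G x y) → Unique (vertices p) → Unique (edges p)
  simple⇒unique-edges nil          _        = []
  simple⇒unique-edges (cons e j p) (x∉ ∷ u) =
    All.tabulate (λ { m refl → All.lookup x∉ (endpoint-∈ p m (joins⇒endpointˡ G {e} j)) refl })
    ∷ simple⇒unique-edges p u

  record Split {x y} (p : Walk G x y) (z : V G) : Set where
    constructor split
    field
      before         : Walk G x z
      after          : Walk G z y
      edges-split    : edges p ≡ edges before ++ edges after
      after-simple   : Unique (vertices p) → Unique (vertices after)
      vertices-split : ∀ {w} → w ∈ vertices p → w ∈ vertices before ⊎ w ∈ vertices after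

  splitAt : ∀ {x y z} (p : Walk G x y) → z ∈ vertices p → Split p z
  splitAt nil            (here refl) = split nil nil refl id inj₁
  splitAt p@(cons _ _ _) (here refl) = split nil p refl id inj₂
  splitAt (cons e j p)   (there m)   =
    let split b a eq u v = splitAt p m in
    split (cons e j b) a (cong (e ∷_) eq) (λ { (_ ∷ up) → u up })
          (λ { (here refl) → inj₁ (here refl) ; (there w) → Sum.map₁ there (v w) })

  open DecMembership (_≟_ {Graph.#V G}) using (_∈?_)

  record Shortening {x y} (p : Walk G x y) : Set where
    field
      path  : Path G x y
      fewer : edges (Path.walk path) ⊆ edges p

  shorten : ∀ {x y} (p : Walk G x y) → Shortening p
  shorten nil = record { path = record { walk = nil ; simple = [] ∷ [] } ; fewer = id }
  shorten {x} (cons e j p) with shorten p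
  ... | record { path = record { walk = q ; simple = u } ; fewer = sub } with x ∈? vertices q
  ... | yes m = record
      { path  = record { walk = after ; simple = after-simple u }
      ; fewer = λ f∈ → there (sub (subst (_ ∈_) (sym edges-split) (∈-++⁺ʳ (edges before) f∈))) }
    where open Split (splitAt q m)
  ... | no x∉ = record
      { path  = record { walk = cons e j q ; simple = All.tabulate (λ { m refl → x∉ m }) ∷ u }
      ; fewer = λ { (here refl) → here refl ; (there m) → there (sub m) } }

-- Bag models and minors

record Model (t : ℕ) (G : Graph) : Set₁ where
  field
    Bag      : Fin t → V G → Set
    bag?     : ∀ i x → Dec (Bag i x)
    disjoint : ∀ {i j x} → Bag i x → Bag j x → i ≡ j
    nonempty : ∀ i → ∃ (Bag i)

  Inside : Fin t → Rel (V G) 0ℓ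
  Inside i x y = Bag i x × Bag i y × Adj G x y

  field
    connected : ∀ i {x y} → Bag i x → Bag i y → Star (Inside i) x y
    touching  : ∀ {i j} → i ≢ j → ∃₂ λ x y → Bag i x × Bag j y × Adj G x y

model-K : ∀ t → Model t (K t)
model-K t = record
  { Bag       = _≡_
  ; bag?      = _≟_
  ; disjoint  = λ { refl refl → refl }
  ; nonempty  = λ i → i , refl
  ; connected = λ { i refl refl → ε }
  ; touching  = λ {i} {j} i≢j → i , j , refl , refl ,
                  simpleGraph-adj (λ i j → ¬? (i ≟ j)) (λ p q → p (sym q)) i≢j i≢j
  }

-- The common part of a contraction and an isomorphism that suffices for pulling models back:
-- preimages of bags stay connected because fibres are, and adjacencies lift.
record Collapse (G G′ : Graph) : Set where
  field
    π          : V G → V G′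
    surjective : ∀ y → ∃[ x ] π x ≡ y
    fibre-conn : ∀ {x y} → π x ≡ π y → x ≡ y ⊎ Adj G x y
    lift       : ∀ {x y} → Adj G′ x y → ∃₂ λ a b → π a ≡ x × π b ≡ y × Adj G a b

lift-joins : ∀ {G G′ : Graph} (π : V G → V G′) {e e′} →
             (∀ {x y} → Joins G e x y → Joins G′ e′ (π x) (π y)) →
             ∀ {x y} → Joins G′ e′ x y → ∃₂ λ a b → π a ≡ x × π b ≡ y × Adj G a b
lift-joins {G} {G′} π {e} {e′} push j with joins-unique G′ {e′} (push (joins-ends G e)) j
... | inj₁ (p , q) = _ , _ , p , q , e , joins-ends G e
... | inj₂ (p , q) = _ , _ , q , p , e , joins-sym G {e} (joins-ends G e)

contraction⇒collapse : ∀ {G e G′} → Contraction G e G′ → Collapse G G′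
contraction⇒collapse {G} {e} {G′} c = record
  { π          = π
  ; surjective = λ y → let x , h = πSurj y in x , h refl
  ; fibre-conn = λ {x} {y} eq → Sum.map₂ (e ,_) (Equivalence.to (fibres x y) eq)
  ; lift       = λ (f , j) → lift-joins {G} {G′} π {from f} {f} joins j
  }
  where
  open Contraction c

≅⇒collapse : ∀ {G G′} → G ≅ G′ → Collapse G G′
≅⇒collapse {G} {G′} iso = record
  { π          = to onV
  ; surjective = λ y → from onV y , strictlyInverseˡ onV y
  ; fibre-conn = λ {x} {y} eq → inj₁ (trans (sym (strictlyInverseʳ onV x)) (trans (cong (from onV) eq) (strictlyInverseʳ onV y)))
  ; lift       = λ (f , j) → lift-joins {G} {G′} (to onV) {from onE f} {f}
                   (λ {x} {y} p → subst (λ g → Joins G′ g (to onV x) (to onV y)) (strictlyInverseˡ onE f) (joins p)) j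
  }
  where
  open _≅_ iso
  open Inverse

module _ {t : ℕ} {G G′ : Graph} (c : Collapse G G′) (M : Model t G′) where
  open Collapse c
  open Model M

  private
    step : ∀ {i x y} → Bag i (π x) → π x ≡ π y → Star (λ a b → Bag i (π a) × Bag i (π b) × Adj G a b) x y
    step {i} b eq with fibre-conn eq
    ... | inj₁ refl = ε
    ... | inj₂ a    = (b , subst (Bag i) eq b , a) ◅ ε

    lift-star : ∀ {i x′ y′} → Star (Inside i) x′ y′ → ∀ {x y} → Bag i x′ → π x ≡ x′ → π y ≡ y′ →
                Star (λ a b → Bag i (π a) × Bag i (π b) × Adj G a b) x y
    lift-star ε bx refl q = step bx (sym q)
    lift-star ((bx , bz , adj) ◅ s) _ refl q with lift adj
    -- The lifted edge may start at the other vertex of the fibre, so a step inside the fibre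
    -- precedes it.
    ... | a , b , p , refl , ab =
      step bx (sym p) ◅◅ ((subst (Bag _) (sym p) bx , bz , ab) ◅ lift-star s bz refl q)

  pullback : Model t G
  pullback = record
    { Bag       = λ i x → Bag i (π x)
    ; bag?      = λ i x → bag? i (π x)
    ; disjoint  = disjoint
    ; nonempty  = λ i → let y , b = nonempty i ; x , eq = surjective y in x , subst (Bag i) (sym eq) b
    ; connected = λ i bx by → lift-star (connected i bx by) bx refl refl
    ; touching  = λ i≢j → let x , y , bx , by , adj = touching i≢j ; a , b , p , q , ab = lift adj
                          in a , b , subst (Bag _) (sym p) bx , subst (Bag _) (sym q) by , ab
    }

≲-model : ∀ {t S G} → S ≲ G → Model t S → Model t G
≲-model {t} {S} {G} sub M = record
  { Bag       = λ i v → ∃[ x ] (onV x ≡ v × Bag i x)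
  ; bag?      = λ i v → any? (λ x → (onV x ≟ v) ×-dec bag? i x)
  ; disjoint  = λ { (x , p , b) (y , q , b′) → disjoint b (subst (Bag _) (onVInj (trans q (sym p))) b′) }
  ; nonempty  = λ i → let x , b = nonempty i in onV x , x , refl , b
  ; connected = λ { i (x , refl , b) (y , refl , b′) → Star.gmap onV
                    (λ { (p , q , a) → (_ , refl , p) , (_ , refl , q) , push a }) (connected i b b′) }
  ; touching  = λ i≢j → let x , y , bx , by , a = touching i≢j in
                  onV x , onV y , (x , refl , bx) , (y , refl , by) , push a
  }
  where
  open _≲_ sub
  open Model M
  push : ∀ {x y} → Adj S x y → Adj G (onV x) (onV y)
  push (e , j) = onE e , joins j

minor⇒model : ∀ {t G} → KMinor t G → Model t G
minor⇒model {t} (S , M , S≲G , contractions , M≅K) =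
  ≲-model S≲G (pull contractions (pullback (≅⇒collapse M≅K) (model-K t)))
  where
  pull : ∀ {S M} → Star ContractEdge S M → Model t M → Model t S
  pull ε             m = m
  pull ((_ , c) ◅ s) m = pullback (contraction⇒collapse c) (pull s m)

-- The edges of S between different classes are exactly one for each pair of
-- classes, so contracting all edges inside the classes produces K t.
record Partition (t : ℕ) (S : Graph) : Set where
  field
    class     : V S → Fin t
    inhabited : ∀ i → ∃[ x ] class x ≡ i

  Within : Rel (V S) 0ℓ
  Within x y = class x ≡ class y × Adj S x y

  field
    connected : ∀ {x y} → class x ≡ class y → Star Within x y
    key       : E (K t) → E S
    key-joins : ∀ k → ∃₂ λ x y → Joins S (key k) x y × Graph.ends (K t) k ≡ (class x , class y)
    key-cover : ∀ {e x y} → Joins S e x y → class x ≢ class y → ∃[ k ] key k ≡ e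

module _ {t : ℕ} {S : Graph} (P : Partition t S) where
  open Partition P
  open Graph S using (ends)

  -- A walk inside a class would have to begin with an edge inside it. Without such edges the
  -- classes are single vertices, and `class` becomes a bijection.
  partition-rigid : (∀ e → class (proj₁ (ends e)) ≢ class (proj₂ (ends e))) → S ≅ K t
  partition-rigid rigid = record
    { onV   = mk↔ₛ′ class (λ i → proj₁ (inhabited i)) (λ i → proj₂ (inhabited i))
                    (λ x → class-injective (proj₂ (inhabited (class x))))
    ; onE   = mk↔ₛ′ unkey key (λ k → key-injective (key-unkey (key k))) key-unkey
    ; joins = joins′
    }
    where
    rigid′ : ∀ {e x y} → Joins S e x y → class x ≢ class y
    rigid′ {e} j eq with joins-unique S {e} (joins-ends S e) j
    ... | inj₁ (refl , refl) = rigid e eq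
    ... | inj₂ (refl , refl) = rigid e (sym eq)

    class-injective : ∀ {x y} → class x ≡ class y → x ≡ y
    class-injective eq with connected eq
    ... | ε = refl
    ... | (same , e , j) ◅ _ = contradiction same (rigid′ {e} j)

    unkey : E S → E (K t)
    unkey e = proj₁ (key-cover (joins-ends S e) (rigid e))

    key-unkey : ∀ e → key (unkey e) ≡ e
    key-unkey e = proj₂ (key-cover (joins-ends S e) (rigid e))

    class-joins : ∀ k {x y} → Joins S (key k) x y → Joins (K t) k (class x) (class y)
    class-joins k j with key-joins k
    ... | _ , _ , j′ , eq with joins-unique S {key k} j j′
    ... | inj₁ (refl , refl) = inj₁ eq
    ... | inj₂ (refl , refl) = inj₂ eq

    key-injective : ∀ {k l} → key k ≡ key l → k ≡ l
    key-injective {k} {l} eq = simpleGraph-simple (λ i j → ¬? (i ≟ j))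
      (class-joins k (joins-ends S (key k)))
      (class-joins l (subst (λ e → Joins S e (proj₁ (ends (key k))) (proj₂ (ends (key k)))) eq (joins-ends S (key k))))

    joins′ : ∀ {e x y} → Joins S e x y → Joins (K t) (unkey e) (class x) (class y)
    joins′ {e} {x} {y} j = class-joins (unkey e) (subst (λ f → Joins S f x y) (sym (key-unkey e)) j)

  module Contract (e₀ : E S) (inside : class (proj₁ (ends e₀)) ≡ class (proj₂ (ends e₀))) where
    private
      a b : V S
      a = proj₁ (ends e₀)
      b = proj₂ (ends e₀)

      Vs : Enumeration (_≢ b)
      Vs = enumerate (λ x → ¬? (x ≟ b))
      module Vs = Enumeration Vs

      merge : ∀ x → Dec (x ≡ b) → Fin Vs.size
      merge x (yes _)  = Vs.indexOf (Graph.loopless S e₀)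
      merge x (no x≢b) = Vs.indexOf x≢b

      π : V S → Fin Vs.size
      π x = merge x (x ≟ b)

      elt-merge : ∀ x d → Vs.elt (merge x d) ≡ x ⊎ (x ≡ b × Vs.elt (merge x d) ≡ a)
      elt-merge x (yes p) = inj₂ (p , Vs.elt-index _)
      elt-merge x (no _)  = inj₁ (Vs.elt-index _)

      -- `π` retracts the vertex set onto the complement of `b`; the facts about fibres and classes
      -- are read off from this description.
      elt-π : ∀ x → Vs.elt (π x) ≡ x ⊎ (x ≡ b × Vs.elt (π x) ≡ a)
      elt-π x = elt-merge x (x ≟ b)

      π-elt : ∀ y → π (Vs.elt y) ≡ y
      π-elt y with elt-π (Vs.elt y)
      ... | inj₁ eq       = Vs.injective eq
      ... | inj₂ (eq , _) = contradiction eq (Vs.satisfies y)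

      πa≡πb : π a ≡ π b
      πa≡πb with elt-π a | elt-π b
      ... | inj₂ (eq , _) | _             = contradiction eq (Graph.loopless S e₀)
      ... | _             | inj₁ eq       = contradiction eq (Vs.satisfies (π b))
      ... | inj₁ p        | inj₂ (_ , q)  = Vs.injective (trans p (sym q))

      class-π : ∀ x → class (Vs.elt (π x)) ≡ class x
      class-π x with elt-π x
      ... | inj₁ eq         = cong class eq
      ... | inj₂ (refl , q) = trans (cong class q) inside

      Es : Enumeration (λ f → π (proj₁ (ends f)) ≢ π (proj₂ (ends f)))
      Es = enumerate (λ f → ¬? (π (proj₁ (ends f)) ≟ π (proj₂ (ends f))))
      module Es = Enumeration Es

      survives′ : ∀ {f x y} → Joins S f x y → π x ≢ π y → π (proj₁ (ends f)) ≢ π (proj₂ (ends f))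
      survives′ {f} j ne with joins-unique S {f} (joins-ends S f) j
      ... | inj₁ (refl , refl) = ne
      ... | inj₂ (refl , refl) = ≢-sym ne

    quotient : Graph
    quotient = record
      { #V = Vs.size ; #E = Es.size
      ; ends = λ f → π (proj₁ (ends (Es.elt f))) , π (proj₂ (ends (Es.elt f)))
      ; loopless = Es.satisfies }

    private
      joins″ : ∀ {f x y} → Joins S (Es.elt f) x y → Joins quotient f (π x) (π y)
      joins″ (inj₁ p) = inj₁ (cong (λ (x , y) → π x , π y) p)
      joins″ (inj₂ p) = inj₂ (cong (λ (x , y) → π x , π y) p)

      fibres⇒ : ∀ x y → π x ≡ π y → x ≡ y ⊎ Joins S e₀ x y
      fibres⇒ x y eq with elt-π x | elt-π y
      ... | inj₁ p          | inj₁ q          = inj₁ (trans (sym p) (trans (cong Vs.elt eq) q))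
      ... | inj₁ p          | inj₂ (refl , q) =
          inj₂ (inj₁ (cong (_, b) (trans (sym q) (trans (cong Vs.elt (sym eq)) p))))
      ... | inj₂ (refl , p) | inj₁ q          = inj₂ (inj₂ (cong (_, b) (trans (sym p) (trans (cong Vs.elt eq) q))))
      ... | inj₂ (refl , _) | inj₂ (refl , _) = inj₁ refl

      fibres⇐ : ∀ x y → x ≡ y ⊎ Joins S e₀ x y → π x ≡ π y
      fibres⇐ x y (inj₁ refl)        = refl
      fibres⇐ x y (inj₂ (inj₁ refl)) = πa≡πb
      fibres⇐ x y (inj₂ (inj₂ refl)) = sym πa≡πb

    contraction : Contraction S e₀ quotient
    contraction = record
      { π        = π
      ; πSurj    = λ y → Vs.elt y , λ { refl → π-elt y }
      ; fibres   = λ x y → mk⇔ (fibres⇒ x y) (fibres⇐ x y)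
      ; from     = Es.elt
      ; fromInj  = Es.injective
      ; joins    = λ {f} → joins″ {f}
      ; survives = λ {f} j ne → Es.indexOf {f} (survives′ {f} j ne) , Es.elt-index _
      }

    smaller : Graph.#V quotient ℕ.< Graph.#V S
    smaller = injective⇒≤ {f = λ { zero → b ; (suc y) → Vs.elt y }}
      λ { {zero}  {zero}  _  → refl
        ; {zero}  {suc y} eq → contradiction (sym eq) (Vs.satisfies y)
        ; {suc x} {zero}  eq → contradiction eq (Vs.satisfies x)
        ; {suc x} {suc y} eq → cong suc (Vs.injective eq) }

    private
      class′ : Fin Vs.size → Fin t
      class′ y = class (Vs.elt y)

      push-star : ∀ {x y} → Star Within x y → Star (λ u v → class′ u ≡ class′ v × Adj quotient u v) (π x) (π y)
      push-star ε = ε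
      push-star {x} (_◅_ {j = z} (same , f , j) s) with π x ≟ π z
      ... | yes eq = subst (λ u → Star _ u _) (sym eq) (push-star s)
      ... | no ne  = (trans (class-π x) (trans same (sym (class-π z))) ,
                      f′ , joins″ {f′} (subst (λ g → Joins S g x z) (sym (Es.elt-index p)) j)) ◅ push-star s
        where
        p : π (proj₁ (ends f)) ≢ π (proj₂ (ends f))
        p = survives′ {f} j ne
        f′ : Fin Es.size
        f′ = Es.indexOf p

      class-≢⇒π-≢ : ∀ {x y} → class x ≢ class y → π x ≢ π y
      class-≢⇒π-≢ {x} {y} ne eq = ne (trans (sym (class-π x)) (trans (cong class′ eq) (class-π y)))

      key-survives : ∀ k → π (proj₁ (ends (key k))) ≢ π (proj₂ (ends (key k)))
      key-survives k with key-joins k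
      ... | x , y , j , eq = survives′ {key k} j (class-≢⇒π-≢
        (λ same → Graph.loopless (K t) k (trans (cong proj₁ eq) (trans same (sym (cong proj₂ eq))))))

    partition : Partition t quotient
    partition = record
      { class     = class′
      ; inhabited = λ i → let x , eq = inhabited i in π x , trans (class-π x) eq
      ; connected = λ {x} {y} same → subst (λ u → Star _ u y) (π-elt x)
                      (subst (Star _ (π (Vs.elt x))) (π-elt y) (push-star (connected same)))
      ; key       = λ k → Es.indexOf (key-survives k)
      ; key-joins = λ k → let x , y , j , eq = key-joins k in
          π x , π y , joins″ {Es.indexOf (key-survives k)} (subst (λ g → Joins S g x y) (sym (Es.elt-index _)) j) ,
          trans eq (sym (cong₂ _,_ (class-π x) (class-π y)))
      ; key-cover = λ {f} {x} {y} → cover {f} {x} {y}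
      }
      where
      cover : ∀ {f x y} → Joins quotient f x y → class′ x ≢ class′ y → ∃[ k ] Es.indexOf (key-survives k) ≡ f
      cover {f} {x} {y} j ne =
        let k , eq = key-cover {Es.elt f} (joins-ends S (Es.elt f)) (differ j)
        in k , Es.injective (trans (Es.elt-index _) eq)
        where
        differ : Joins quotient f x y → class (proj₁ (ends (Es.elt f))) ≢ class (proj₂ (ends (Es.elt f)))
        differ (inj₁ refl) same = ne (trans (class-π _) (trans same (sym (class-π _))))
        differ (inj₂ refl) same = ne (trans (class-π _) (trans (sym same) (sym (class-π _))))

-- Each contraction removes a vertex, so the bound `n` makes the recursion structural.
contractAll : ∀ {t} n {S} → Graph.#V S ℕ.≤ n → Partition t S → ∃[ M ] (Star ContractEdge S M × M ≅ K t)
contractAll {t} n {S} bound P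
  with any? (λ e → Partition.class P (proj₁ (Graph.ends S e)) ≟ Partition.class P (proj₂ (Graph.ends S e)))
... | no rigid = S , ε , partition-rigid P (λ e eq → rigid (e , eq))
contractAll zero {S} bound P | yes (e , eq) = contradiction (ℕₚ.<-≤-trans (Contract.smaller P e eq) bound) λ ()
contractAll (suc n) {S} bound P | yes (e , eq) =
  let M , s , iso = contractAll n (ℕ.s≤s⁻¹ (ℕₚ.<-≤-trans (Contract.smaller P e eq) bound)) (Contract.partition P e eq)
  in M , (e , Contract.contraction P e eq) ◅ s , iso

module _ {t : ℕ} {G : Graph} (M : Model t G) where
  open Model M
  open Graph G using (ends)

  private
    chosen : (k : E (K t)) → ∃₂ λ x y → Bag (proj₁ (Graph.ends (K t) k)) x × Bag (proj₂ (Graph.ends (K t) k)) y × Adj G x y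
    chosen k = touching (Graph.loopless (K t) k)

    cross : E (K t) → E G
    cross k = let _ , _ , _ , _ , e , _ = chosen k in e

    -- Between two bags only the chosen edge is kept; otherwise contracting the bags could leave
    -- parallel edges instead of `K t`.
    Keep : E G → Set
    Keep e = (∃[ i ] (Bag i (proj₁ (ends e)) × Bag i (proj₂ (ends e)))) ⊎ (∃[ k ] cross k ≡ e)

    Covered : V G → Set
    Covered x = ∃[ i ] Bag i x

    Vs : Enumeration Covered
    Vs = enumerate (λ x → any? (λ i → bag? i x))
    module Vs = Enumeration Vs

    Es : Enumeration Keep
    Es = enumerate (λ e → any? (λ i → bag? i _ ×-dec bag? i _) ⊎-dec any? (λ k → cross k ≟ e))
    module Es = Enumeration Es

    keep-covered : ∀ {e} → Keep e → Covered (proj₁ (ends e)) × Covered (proj₂ (ends e))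
    keep-covered (inj₁ (i , p , q)) = (i , p) , (i , q)
    keep-covered (inj₂ (k , refl)) with chosen k
    ... | x , y , p , q , e , inj₁ refl = (_ , p) , (_ , q)
    ... | x , y , p , q , e , inj₂ refl = (_ , q) , (_ , p)

    end₁ end₂ : Fin Es.size → Fin Vs.size
    end₁ f = Vs.indexOf (proj₁ (keep-covered (Es.satisfies f)))
    end₂ f = Vs.indexOf (proj₂ (keep-covered (Es.satisfies f)))

    S : Graph
    S = record
      { #V = Vs.size ; #E = Es.size
      ; ends     = λ f → end₁ f , end₂ f
      ; loopless = λ f eq → Graph.loopless G (Es.elt f)
          (trans (sym (Vs.elt-index _)) (trans (cong Vs.elt eq) (Vs.elt-index _)))
      }

    down : ∀ {f x y} → Joins S f x y → Joins G (Es.elt f) (Vs.elt x) (Vs.elt y)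
    down {f} (inj₁ refl) = inj₁ (sym (cong₂ _,_ (Vs.elt-index _) (Vs.elt-index _)))
    down {f} (inj₂ refl) = inj₂ (sym (cong₂ _,_ (Vs.elt-index _) (Vs.elt-index _)))

    up : ∀ {f x y} → Joins G (Es.elt f) (Vs.elt x) (Vs.elt y) → Joins S f x y
    up {f} j with joins-unique G {Es.elt f} (down {f} (joins-ends S f)) j
    ... | inj₁ (p , q) = inj₁ (cong₂ _,_ (Vs.injective p) (Vs.injective q))
    ... | inj₂ (p , q) = inj₂ (cong₂ _,_ (Vs.injective p) (Vs.injective q))

    up-edge : ∀ {e x y} (k : Keep e) → Joins G e (Vs.elt x) (Vs.elt y) → Joins S (Es.indexOf k) x y
    up-edge k j = up {Es.indexOf k} (subst (λ e → Joins G e _ _) (sym (Es.elt-index k)) j)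

    class : V S → Fin t
    class x = proj₁ (Vs.satisfies x)

    class-bag : ∀ x → Bag (class x) (Vs.elt x)
    class-bag x = proj₂ (Vs.satisfies x)

    class-unique : ∀ {i x} → Bag i (Vs.elt x) → class x ≡ i
    class-unique {x = x} b = disjoint (class-bag x) b

    keep-inside : ∀ {i e x y} → Bag i x → Bag i y → Joins G e x y → Keep e
    keep-inside bx by (inj₁ refl) = inj₁ (_ , bx , by)
    keep-inside bx by (inj₂ refl) = inj₁ (_ , by , bx)

    lift-star : ∀ {i a b} → Star (Inside i) a b → ∀ x y → Vs.elt x ≡ a → Vs.elt y ≡ b →
                Star (λ u v → class u ≡ class v × Adj S u v) x y
    lift-star ε x y refl q = subst (Star _ x) (Vs.injective (sym q)) ε
    lift-star {i} (_◅_ {j = c} (bx , bz , e , j) s) x y refl q =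
      (trans (class-unique bx) (sym (class-unique bz′)) ,
       Es.indexOf kept , up-edge kept (subst (λ v → Joins G e _ v) (sym z≡) j))
      ◅ lift-star s z y z≡ q
      where
      z : Fin Vs.size
      z = Vs.indexOf {c} (i , bz)
      z≡ : Vs.elt z ≡ c
      z≡ = Vs.elt-index (i , bz)
      bz′ : Bag i (Vs.elt z)
      bz′ = subst (Bag i) (sym z≡) bz
      kept : Keep e
      kept = keep-inside bx bz j

    key : E (K t) → E S
    key k = Es.indexOf {cross k} (inj₂ (k , refl))

    partitionS : Partition t S
    partitionS = record
      { class     = class
      ; inhabited = λ i → let x , b = nonempty i in
                      Vs.indexOf (i , b) , class-unique (subst (Bag i) (sym (Vs.elt-index (i , b))) b)
      ; connected = λ {x} {y} eq → lift-star
                      (connected (class x) (class-bag x) (subst (λ i → Bag i _) (sym eq) (class-bag y))) x y refl refl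
      ; key       = key
      ; key-joins = key-joins
      ; key-cover = λ {e} → key-cover {e}
      }
      where
      cast : ∀ {x x′ y y′} → x ≡ x′ → y ≡ y′ → ∀ {e} → Joins G e x y → Joins G e x′ y′
      cast refl refl j = j
      key-joins : ∀ k → ∃₂ λ x y → Joins S (key k) x y × Graph.ends (K t) k ≡ (class x , class y)
      key-joins k =
        let x , y , p , q , e , j = chosen k
            x≡ = Vs.elt-index (_ , p)
            y≡ = Vs.elt-index (_ , q)
        in Vs.indexOf (_ , p) , Vs.indexOf (_ , q) ,
           up-edge (inj₂ (k , refl)) (cast (sym x≡) (sym y≡) {e} j) ,
           sym (cong₂ _,_ (class-unique (subst (Bag _) (sym x≡) p)) (class-unique (subst (Bag _) (sym y≡) q)))
      key-cover : ∀ {e x y} → Joins S e x y → class x ≢ class y → ∃[ k ] key k ≡ e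
      key-cover {e} {x} {y} j ne = found (Es.satisfies e)
        where
        found : Keep (Es.elt e) → ∃[ k ] key k ≡ e
        found (inj₂ (k , eq)) = k , Es.injective (trans (Es.elt-index _) eq)
        found (inj₁ (i , p , q)) with joins-unique G {Es.elt e} (joins-ends G (Es.elt e)) (down {e} j)
        ... | inj₁ (r , s) =
            contradiction (trans (class-unique (subst (Bag i) r p)) (sym (class-unique (subst (Bag i) s q)))) ne
        ... | inj₂ (r , s) =
            contradiction (trans (class-unique (subst (Bag i) s q)) (sym (class-unique (subst (Bag i) r p)))) ne

    S≲G : S ≲ G
    S≲G = record { onV = Vs.elt ; onE = Es.elt ; onVInj = Vs.injective ; onEInj = Es.injective
                 ; joins = λ {f} → down {f} }

  model⇒minor : KMinor t G
  model⇒minor = let M′ , s , iso = contractAll (Graph.#V S) ℕₚ.≤-refl partitionS in S , M′ , S≲G , s , iso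

-- Immersions from models with at most four bags

unique-++⇒disjoint : {A : Set} (xs : List A) {ys : List A} → Unique (xs ++ ys) → Disjoint xs ys
unique-++⇒disjoint (x ∷ xs) (x∉ ∷ _) (here refl , m) = All.lookup x∉ (∈-++⁺ʳ xs m) refl
unique-++⇒disjoint (x ∷ xs) (_ ∷ u)  (there m , m′)  = unique-++⇒disjoint xs u (m , m′)

Spanned : (G : Graph) → (V G → Set) → E G → Set
Spanned G B e = ∀ {x} → Graph.Endpoint G e x → B x

module _ {G : Graph} where
  open DecMembership (_≟_ {Graph.#V G}) using (_∈?_)

  record FirstHit {x y r z} (p : Walk G x y) (q : Walk G r z) : Set where
    field
      {point} : V G
      on      : point ∈ vertices p
      leg     : Walk G r point
      leg⊆    : edges leg ⊆ edges q
      avoids  : Disjoint (edges leg) (edges p)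

  -- Each edge of the leg has an end off `p`, whereas all ends of edges of `p` lie on `p`; this
  -- gives `avoids`.
  firstHit : ∀ {x y r z} (p : Walk G x y) (q : Walk G r z) → z ∈ vertices p → FirstHit p q
  firstHit p nil z∈ = record { on = z∈ ; leg = nil ; leg⊆ = id ; avoids = λ { (() , _) } }
  firstHit {r = r} p (cons e j q) z∈ with r ∈? vertices p
  ... | yes r∈ = record { on = r∈ ; leg = nil ; leg⊆ = λ () ; avoids = λ { (() , _) } }
  ... | no r∉  = record
      { on     = on
      ; leg    = cons e j leg
      ; leg⊆   = λ { (here refl) → here refl ; (there m) → there (leg⊆ m) }
      ; avoids = λ { (here refl , m) → r∉ (endpoint-∈ p m (joins⇒endpointˡ G {e} j))
                   ; (there m , m′) → avoids (m , m′) }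
      }
    where open FirstHit (firstHit p q z∈)

  start-in : ∀ {B x y} (p : Walk G x y) → (∀ {e} → e ∈ edges p → Spanned G B e) → B y → B x
  start-in nil          _   by = by
  start-in (cons e j _) inB _  = inB (here refl) (joins⇒endpointˡ G {e} j)

  record Spider (B : V G → Set) {m : ℕ} (τ : Fin m → V G) : Set where
    field
      {centre}  : V G
      centre-in : B centre
      leg       : ∀ k → Walk G centre (τ k)
      leg-in    : ∀ k {e} → e ∈ edges (leg k) → Spanned G B e
      disjoint  : ∀ {k l e} → e ∈ edges (leg k) → e ∈ edges (leg l) → k ≡ l

  -- Three terminals: a path joins two of them, and a walk from the third one
  -- is followed until it first meets that path.
  spider : (B : V G → Set) → ∃ B →
           (∀ {x y} → B x → B y → Σ (Walk G x y) λ p → ∀ {e} → e ∈ edges p → Spanned G B e) →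
           ∀ {m} → m ℕ.≤ 3 → (τ : Fin m → V G) → (∀ k → B (τ k)) → Spider B τ
  spider B (_ , b) link {0} _ τ bτ = record { centre-in = b ; leg = λ () ; leg-in = λ () ; disjoint = λ { {()} } }
  spider B _ link {1} _ τ bτ = record
    { centre-in = bτ zero ; leg = λ { zero → nil } ; leg-in = λ { zero () } ; disjoint = λ { {zero} () } }
  spider B _ link {2} _ τ bτ = record
    { centre-in = bτ zero
    ; leg      = λ { zero → nil ; (suc zero) → proj₁ l }
    ; leg-in   = λ { (suc zero) → proj₂ l }
    ; disjoint = λ { {suc zero} {suc zero} _ _ → refl }
    }
    where l = link (bτ zero) (bτ (suc zero))
  spider B _ link {3} _ τ bτ = record
    { centre-in = start-in after (λ m → inP (∈-++⁺ʳ (edges before) m)) (bτ (suc zero))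
    ; leg       = legs
    ; leg-in    = λ { zero m → inP (∈-++⁺ˡ (∈-rev⁻ before m))
                    ; (suc zero) m → inP (∈-++⁺ʳ (edges before) m)
                    ; (suc (suc zero)) m → proj₂ l₂ (leg⊆ (∈-rev⁻ leg m)) }
    ; disjoint  = disj
    }
    where
    l₁ = link (bτ zero) (bτ (suc zero))
    l₂ = link (bτ (suc (suc zero))) (bτ zero)
    open Shortening (shorten (proj₁ l₁))
    open Path path
    open FirstHit (firstHit walk (proj₁ l₂) (start-∈ walk))
    open Split (splitAt walk on)
    inP′ : ∀ {e} → e ∈ edges before ++ edges after → e ∈ edges walk
    inP′ = subst (_ ∈_) (sym edges-split)
    inP : ∀ {e} → e ∈ edges before ++ edges after → Spanned G B e
    inP m = proj₂ l₁ (fewer (inP′ m))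
    legs : ∀ k → Walk G point (τ k)
    legs zero             = rev before
    legs (suc zero)       = after
    legs (suc (suc zero)) = rev leg
    apart : Disjoint (edges before) (edges after)
    apart = unique-++⇒disjoint (edges before) (subst Unique edges-split (simple⇒unique-edges walk simple))
    disj : ∀ {k l e} → e ∈ edges (legs k) → e ∈ edges (legs l) → k ≡ l
    disj {zero} {zero} _ _ = refl
    disj {zero} {suc zero} m m′ = contradiction (∈-rev⁻ before m , m′) apart
    disj {zero} {suc (suc zero)} m m′ = contradiction (∈-rev⁻ leg m′ , inP′ (∈-++⁺ˡ (∈-rev⁻ before m))) avoids
    disj {suc zero} {zero} m m′ = contradiction (∈-rev⁻ before m′ , m) apart
    disj {suc zero} {suc zero} _ _ = refl
    disj {suc zero} {suc (suc zero)} m m′ = contradiction (∈-rev⁻ leg m′ , inP′ (∈-++⁺ʳ (edges before) m)) avoids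
    disj {suc (suc zero)} {zero} m m′ = contradiction (∈-rev⁻ leg m , inP′ (∈-++⁺ˡ (∈-rev⁻ before m′))) avoids
    disj {suc (suc zero)} {suc zero} m m′ = contradiction (∈-rev⁻ leg m , inP′ (∈-++⁺ʳ (edges before) m′)) avoids
    disj {suc (suc zero)} {suc (suc zero)} _ _ = refl
  spider B _ link {suc (suc (suc (suc m)))} (s≤s (s≤s (s≤s ()))) τ bτ

module _ {m : ℕ} (m≤3 : m ℕ.≤ 3) {G : Graph} (M : Model (suc m) G) where
  open Model M
  open Graph G using (ends; Endpoint)

  private
    t : ℕ
    t = suc m

    -- Both terminals of a pair come from the same instance of `touching`, with the smaller index
    -- first, so that an edge joins them. The diagonal value is only a filler.
    terminal : ∀ i j → Tri (i < j) (i ≡ j) (j < i) → ∃ (Bag i)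
    terminal i j (tri< p _ _) = let x , _ , b , _ = touching (<⇒≢ p) in x , b
    terminal i j (tri≈ _ _ _) = nonempty i
    terminal i j (tri> _ _ p) = let _ , y , _ , b , _ = touching (<⇒≢ p) in y , b

    τ : Fin t → Fin t → V G
    τ i j = proj₁ (terminal i j (<-cmp i j))

    crossing : ∀ {u v} → u < v → Adj G (τ u v) (τ v u)
    crossing {u} {v} u<v with <-cmp u v | <-cmp v u
    ... | tri< p _ _ | tri> _ _ q rewrite <-irrelevant p q = let _ , _ , _ , _ , a = touching (<⇒≢ q) in a
    ... | tri≈ ¬p _ _ | _ = contradiction u<v ¬p
    ... | tri> ¬p _ _ | _ = contradiction u<v ¬p
    ... | _ | tri< _ _ ¬p = contradiction u<v ¬p
    ... | _ | tri≈ _ _ ¬p = contradiction u<v ¬p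

    star⇒walk : ∀ {i x y} → Star (Inside i) x y → Σ (Walk G x y) λ p → ∀ {e} → e ∈ edges p → Spanned G (Bag i) e
    star⇒walk ε = nil , λ ()
    star⇒walk {i} ((bx , by , e , j) ◅ s) = let p , inp = star⇒walk s in
      cons e j p , λ { (here refl) q → [ (λ { refl → bx }) , (λ { refl → by }) ] (endpoint-cases G {e} j q)
                     ; (there n) → inp n }

    spiders : ∀ i → Spider (Bag i) (λ k → τ i (punchIn i k))
    spiders i = spider (Bag i) (nonempty i) (λ p q → star⇒walk (connected i p q)) m≤3 _
      (λ k → proj₂ (terminal i (punchIn i k) (<-cmp i (punchIn i k))))

    module S i = Spider (spiders i)

    -- The legs of a spider are numbered by `punchIn`. Recording the edges next to the transported
    -- walk keeps the disjointness of the legs available.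
    leg′ : ∀ {i j} (ne : i ≢ j) → Σ (Walk G (S.centre i) (τ i j)) λ p → edges p ≡ edges (S.leg i (punchOut ne))
    leg′ {i} {j} ne = recast (punchIn-punchOut ne)
      where
      recast : ∀ {k j} → punchIn i k ≡ j → Σ (Walk G (S.centre i) (τ i j)) λ p → edges p ≡ edges (S.leg i k)
      recast {k} refl = S.leg i k , refl

    leg : ∀ {i j} → i ≢ j → Walk G (S.centre i) (τ i j)
    leg ne = proj₁ (leg′ ne)

    leg-in : ∀ {i j e} (ne : i ≢ j) → e ∈ edges (leg ne) → Spanned G (Bag i) e
    leg-in {i} ne e∈ = S.leg-in i (punchOut ne) (subst (_ ∈_) (proj₂ (leg′ ne)) e∈)

    route : ∀ {u v} → u < v → Walk G (S.centre u) (S.centre v)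
    route u<v = leg (<⇒≢ u<v) ⟫ cons (proj₁ a) (proj₂ a) (rev (leg (≢-sym (<⇒≢ u<v))))
      where a = crossing u<v

    InLeg : E G → Fin t → Fin t → Set
    InLeg e i j = Σ (i ≢ j) λ ne → e ∈ edges (leg ne)

    InCross : E G → Fin t → Fin t → Set
    InCross e i j = ∃₂ λ x y → Joins G e x y × Bag i x × Bag j y

    route⁻ : ∀ {u v e} (u<v : u < v) → e ∈ edges (route u<v) → InLeg e u v ⊎ InLeg e v u ⊎ InCross e u v
    route⁻ {u} {v} u<v e∈ with ∈-⟫⁻ (leg (<⇒≢ u<v)) _ e∈
    ... | inj₁ n = inj₁ (_ , n)
    ... | inj₂ (there n) = inj₂ (inj₁ (_ , ∈-rev⁻ (leg (≢-sym (<⇒≢ u<v))) n))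
    ... | inj₂ (here refl) = inj₂ (inj₂ (_ , _ , proj₂ (crossing u<v) ,
            proj₂ (terminal u v (<-cmp u v)) , proj₂ (terminal v u (<-cmp v u))))

    leg-leg : ∀ {e i j k l} → InLeg e i j → InLeg e k l → i ≡ k × j ≡ l
    leg-leg {e} {i} (ne , p) (ne′ , q) with disjoint (leg-in ne p {proj₁ (ends e)} (inj₁ refl)) (leg-in ne′ q (inj₁ refl))
    ... | refl =
        refl , punchOut-injective ne ne′ (S.disjoint i (subst (_ ∈_) (proj₂ (leg′ ne)) p) (subst (_ ∈_) (proj₂ (leg′ ne′)) q))

    leg-cross : ∀ {e i j k l} → InLeg e i j → InCross e k l → k ≡ l
    leg-cross {e} (ne , p) (x , y , j , bx , by) =
      trans (disjoint bx (leg-in ne p (joins⇒endpointˡ G {e} j)))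
            (disjoint (leg-in ne p (joins⇒endpointʳ G {e} j)) by)

    cross-cross : ∀ {e i j k l} → InCross e i j → InCross e k l → (i ≡ k × j ≡ l) ⊎ (i ≡ l × j ≡ k)
    cross-cross {e} (_ , _ , j , bx , by) (_ , _ , j′ , bx′ , by′) with joins-unique G {e} j j′
    ... | inj₁ (refl , refl) = inj₁ (disjoint bx bx′ , disjoint by by′)
    ... | inj₂ (refl , refl) = inj₂ (disjoint bx by′ , disjoint by bx′)

    -- A leg edge lies inside one bag and a crossing edge between two, so the kinds never mix. The
    -- pair is recovered from the two bags of a crossing edge, or from the bag of a leg edge and its
    -- leg there.
    same-pair : ∀ {e u v u′ v′} → u < v → u′ < v′ →
                InLeg e u v ⊎ InLeg e v u ⊎ InCross e u v →
                InLeg e u′ v′ ⊎ InLeg e v′ u′ ⊎ InCross e u′ v′ →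
                (u ≡ u′ × v ≡ v′) ⊎ (u ≡ v′ × v ≡ u′)
    same-pair _ _ (inj₁ a) (inj₁ b) = inj₁ (leg-leg a b)
    same-pair _ _ (inj₁ a) (inj₂ (inj₁ b)) = inj₂ (leg-leg a b)
    same-pair _ _ (inj₂ (inj₁ a)) (inj₁ b) = inj₂ (let p , q = leg-leg a b in q , p)
    same-pair _ _ (inj₂ (inj₁ a)) (inj₂ (inj₁ b)) = inj₁ (let p , q = leg-leg a b in q , p)
    same-pair _ _ (inj₂ (inj₂ a)) (inj₂ (inj₂ b)) = cross-cross a b
    same-pair _ lt (inj₁ a) (inj₂ (inj₂ b)) = contradiction (leg-cross a b) (<⇒≢ lt)
    same-pair _ lt (inj₂ (inj₁ a)) (inj₂ (inj₂ b)) = contradiction (leg-cross a b) (<⇒≢ lt)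
    same-pair lt _ (inj₂ (inj₂ a)) (inj₁ b) = contradiction (leg-cross b a) (<⇒≢ lt)
    same-pair lt _ (inj₂ (inj₂ a)) (inj₂ (inj₁ b)) = contradiction (leg-cross b a) (<⇒≢ lt)

  model⇒immersion : KImmersion t G
  model⇒immersion = record
    { φ        = S.centre
    ; φInj     = λ {i} {j} eq → disjoint (S.centre-in i) (subst (Bag j) (sym eq) (S.centre-in j))
    ; path     = λ u v u<v → Shortening.path (shorten (route u<v))
    ; disjoint = disj
    }
    where
    disj : ∀ {u v u′ v′} (u<v : u < v) (u′<v′ : u′ < v′) → (u , v) ≢ (u′ , v′) →
           Disjoint (edges (Path.walk (Shortening.path (shorten (route u<v)))))
                    (edges (Path.walk (Shortening.path (shorten (route u′<v′)))))
    disj u<v u′<v′ ne (p , q) with same-pair u<v u′<v′ (route⁻ u<v (Shortening.fewer (shorten (route u<v)) p))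
                                                     (route⁻ u′<v′ (Shortening.fewer (shorten (route u′<v′)) q))
    ... | inj₁ (refl , refl) = ne refl
    ... | inj₂ (refl , refl) = <-asym u<v u′<v′

-- A line graph with an immersion but no minor

isLineGraph : ∀ H → IsLineGraph (L H)
isLineGraph H = H , record { onV = ↔-id _ ; onE = ↔-id _ ; joins = id }

L-adj : ∀ H {e f} → e ≢ f → Graph.ShareEndpoint H e f → Adj (L H) e f
L-adj H = simpleGraph-adj (Graph.shareEndpoint? H) (share-sym H)

L-adj⁻ : ∀ H {e f} → Adj (L H) e f → Graph.ShareEndpoint H e f
L-adj⁻ H (_ , j) = simpleGraph-related (Graph.shareEndpoint? H) (share-sym H) j

apart : {A : Set} {a b c d x : A} → a ≢ c → a ≢ d → b ≢ c → b ≢ d → x ≡ a ⊎ x ≡ b → x ≡ c ⊎ x ≡ d → ⊥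
apart a≢c _   _   _   (inj₁ refl) (inj₁ eq) = a≢c eq
apart _   a≢d _   _   (inj₁ refl) (inj₂ eq) = a≢d eq
apart _   _   b≢c _   (inj₂ refl) (inj₁ eq) = b≢c eq
apart _   _   _   b≢d (inj₂ refl) (inj₂ eq) = b≢d eq

-- K₄ with one edge replaced by a class of parallel edges (5F and up); the
-- three pairs of opposite edges of K₄ are 0F-5F, 1F-2F and 3F-4F.
module ThickK₄ (k : ℕ) where

  fatEnds : Fin (6 ℕ.+ k) → Fin 4 × Fin 4
  fatEnds 0F = 0F , 1F
  fatEnds 1F = 0F , 2F
  fatEnds 2F = 1F , 3F
  fatEnds 3F = 0F , 3F
  fatEnds 4F = 1F , 2F
  fatEnds (suc (suc (suc (suc (suc _))))) = 2F , 3F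

  H : Graph
  H = record { #V = 4 ; #E = 6 ℕ.+ k ; ends = fatEnds ; loopless = loopless }
    where
    loopless : ∀ e → proj₁ (fatEnds e) ≢ proj₂ (fatEnds e)
    loopless 0F ()
    loopless 1F ()
    loopless 2F ()
    loopless 3F ()
    loopless 4F ()
    loopless (suc (suc (suc (suc (suc _))))) ()

  open Graph H using (ShareEndpoint)

  -- Branch vertices are the vertices from `1F` on, so indices are shifted by one: these are the
  -- opposite pairs 1F-2F and 3F-4F. The opposite of 5F is the omitted vertex `0F`.
  Opposite : Fin (5 ℕ.+ k) → Fin (5 ℕ.+ k) → Set
  Opposite u v = (u ≡ 0F × v ≡ 1F) ⊎ (u ≡ 2F × v ≡ 3F)

  related : ∀ u v → u < v → ShareEndpoint (suc u) (suc v) ⊎ Opposite u v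
  related 0F 1F _ = inj₂ (inj₁ (refl , refl))
  related 0F 2F _ = inj₁ (0F , inj₁ refl , inj₁ refl)
  related 0F 3F _ = inj₁ (2F , inj₂ refl , inj₂ refl)
  related 0F (suc (suc (suc (suc _)))) _ = inj₁ (2F , inj₂ refl , inj₁ refl)
  related 1F 2F _ = inj₁ (3F , inj₂ refl , inj₂ refl)
  related 1F 3F _ = inj₁ (1F , inj₁ refl , inj₁ refl)
  related 1F (suc (suc (suc (suc _)))) _ = inj₁ (3F , inj₂ refl , inj₂ refl)
  related 2F 3F _ = inj₂ (inj₂ (refl , refl))
  related 2F (suc (suc (suc (suc _)))) _ = inj₁ (3F , inj₂ refl , inj₂ refl)
  related 3F (suc (suc (suc (suc _)))) _ = inj₁ (2F , inj₂ refl , inj₁ refl)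
  related (suc (suc (suc (suc _)))) (suc (suc (suc (suc _)))) _ = inj₁ (2F , inj₁ refl , inj₁ refl)
  related 1F 1F (s≤s ())
  related 2F 1F (s≤s ())
  related 2F 2F (s≤s (s≤s ()))
  related 3F 1F (s≤s ())
  related 3F 2F (s≤s (s≤s ()))
  related 3F 3F (s≤s (s≤s (s≤s ())))
  related (suc (suc (suc (suc _)))) 1F (s≤s ())
  related (suc (suc (suc (suc _)))) 2F (s≤s (s≤s ()))
  related (suc (suc (suc (suc _)))) 3F (s≤s (s≤s (s≤s ())))

  opposite-share : ∀ {u v} → Opposite u v → ShareEndpoint 0F (suc u) × ShareEndpoint 0F (suc v)
  opposite-share (inj₁ (refl , refl)) = (0F , inj₁ refl , inj₁ refl) , (1F , inj₂ refl , inj₁ refl)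
  opposite-share (inj₂ (refl , refl)) = (0F , inj₁ refl , inj₁ refl) , (1F , inj₂ refl , inj₁ refl)

  private
    edge< : ∀ {x y} → x < y → ShareEndpoint x y → ∃[ e ] Graph.ends (L H) e ≡ (x , y)
    edge< = simpleGraph-edge< (Graph.shareEndpoint? H)

    route : ∀ {u v} → u < v → ShareEndpoint (suc u) (suc v) ⊎ Opposite u v → Path (L H) (suc u) (suc v)
    route u<v (inj₁ s) = let e , eq = edge< (s≤s u<v) s in record
      { walk   = cons e (inj₁ eq) nil
      ; simple = ((<⇒≢ u<v ∘ Finₚ.suc-injective) ∷ []) ∷ [] ∷ [] }
    route {u} {v} u<v (inj₂ o) =
      let e , eq   = edge< {0F} {suc u} (s≤s z≤n) (proj₁ (opposite-share o))
          e′ , eq′ = edge< {0F} {suc v} (s≤s z≤n) (proj₂ (opposite-share o))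
      in record
      { walk   = cons e (inj₂ eq) (cons e′ (inj₁ eq′) nil)
      ; simple = ((λ ()) ∷ (<⇒≢ u<v ∘ Finₚ.suc-injective) ∷ []) ∷ ((λ ()) ∷ []) ∷ [] ∷ [] }

    Used : Fin (5 ℕ.+ k) → Fin (5 ℕ.+ k) → Fin (6 ℕ.+ k) × Fin (6 ℕ.+ k) → Set
    Used u v p = p ≡ (suc u , suc v) ⊎ (Opposite u v × (p ≡ (0F , suc u) ⊎ p ≡ (0F , suc v)))

    route-uses : ∀ {u v} (u<v : u < v) r {e} → e ∈ edges (Path.walk (route u<v r)) → Used u v (Graph.ends (L H) e)
    route-uses {u} {v} u<v (inj₁ s) (here refl) = inj₁ (proj₂ (edge< (s≤s u<v) s))
    route-uses {u} {v} u<v (inj₂ o) (here refl) =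
        inj₂ (o , inj₁ (proj₂ (edge< {0F} {suc u} (s≤s z≤n) (proj₁ (opposite-share o)))))
    route-uses {u} {v} u<v (inj₂ o) (there (here refl)) =
        inj₂ (o , inj₂ (proj₂ (edge< {0F} {suc v} (s≤s z≤n) (proj₂ (opposite-share o)))))

    opposite-meet : ∀ {u v u′ v′ w} → Opposite u v → Opposite u′ v′ → w ≡ u ⊎ w ≡ v → w ≡ u′ ⊎ w ≡ v′ → u ≡ u′ × v ≡ v′
    opposite-meet (inj₁ (refl , refl)) (inj₁ (refl , refl)) _ _ = refl , refl
    opposite-meet (inj₂ (refl , refl)) (inj₂ (refl , refl)) _ _ = refl , refl
    opposite-meet (inj₁ (refl , refl)) (inj₂ (refl , refl)) p q = ⊥-elim (apart (λ ()) (λ ()) (λ ()) (λ ()) p q)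
    opposite-meet (inj₂ (refl , refl)) (inj₁ (refl , refl)) p q = ⊥-elim (apart (λ ()) (λ ()) (λ ()) (λ ()) p q)

    spoke : ∀ {u v} {p : Fin (6 ℕ.+ k) × Fin (6 ℕ.+ k)} → p ≡ (0F , suc u) ⊎ p ≡ (0F , suc v) → ∃[ w ] (p ≡ (0F , suc w) × (w ≡ u ⊎ w ≡ v))
    spoke (inj₁ eq) = _ , eq , inj₁ refl
    spoke (inj₂ eq) = _ , eq , inj₂ refl

    used-unique : ∀ {u v u′ v′ p} → Used u v p → Used u′ v′ p → u ≡ u′ × v ≡ v′
    used-unique (inj₁ refl) (inj₁ eq) = let a , b = ,-injective eq in Finₚ.suc-injective a , Finₚ.suc-injective b
    used-unique (inj₁ refl) (inj₂ (_ , inj₁ ()))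
    used-unique (inj₁ refl) (inj₂ (_ , inj₂ ()))
    used-unique (inj₂ (_ , inj₁ refl)) (inj₁ ())
    used-unique (inj₂ (_ , inj₂ refl)) (inj₁ ())
    used-unique (inj₂ (o , s)) (inj₂ (o′ , s′)) with spoke s | spoke s′
    ... | w , refl , c | w′ , eq , c′ with Finₚ.suc-injective (proj₂ (,-injective eq))
    ... | refl = opposite-meet o o′ c c′

  -- The two detours through `0F` use the four edges from it to `1F`, `2F`, `3F` and `4F` once each;
  -- every other path is a single edge that avoids `0F`.
  immersion : KImmersion (5 ℕ.+ k) (L H)
  immersion = record
    { φ        = suc
    ; φInj     = Finₚ.suc-injective
    ; path     = λ u v u<v → route u<v (related u v u<v)
    ; disjoint = λ {u} {v} {u′} {v′} p q ne (m , m′) →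
        let a , b = used-unique (route-uses p (related u v p) m) (route-uses q (related u′ v′ q) m′)
        in ne (cong₂ _,_ a b)
    }

  -- The bags leave out, or double up on, at most one vertex, so some two
  -- opposite vertices are bags of their own.
  module _ (M : Model (5 ℕ.+ k) (L H)) where
    open Model M

    private
      rep : Fin (5 ℕ.+ k) → Fin (6 ℕ.+ k)
      rep i = proj₁ (nonempty i)

      rep-bag : ∀ i → Bag i (rep i)
      rep-bag i = proj₂ (nonempty i)

      -- This concerns representatives only. A missed vertex may still belong to a bag, and then the
      -- representative of that bag is `Doubled`.
      Missed : Fin (6 ℕ.+ k) → Set
      Missed y = ∀ i → rep i ≢ y

      rep-injective : ∀ {i j} → rep i ≡ rep j → i ≡ j
      rep-injective {i} {j} eq = disjoint (rep-bag i) (subst (Bag j) (sym eq) (rep-bag j))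

      missed-unique : ∀ {y z} → Missed y → Missed z → y ≡ z
      missed-unique {y} {z} my mz with y ≟ z
      ... | yes eq = eq
      ... | no ne  = contradiction (injective⇒≤ {f = f} f-inj) ℕₚ.1+n≰n
        where
        f : Fin (7 ℕ.+ k) → Fin (6 ℕ.+ k)
        f zero          = y
        f (suc zero)    = z
        f (suc (suc i)) = rep i
        f-inj : ∀ {i j} → f i ≡ f j → i ≡ j
        f-inj {zero}        {zero}        _  = refl
        f-inj {zero}        {suc zero}    eq = contradiction eq ne
        f-inj {zero}        {suc (suc j)} eq = contradiction (sym eq) (my j)
        f-inj {suc zero}    {zero}        eq = contradiction (sym eq) ne
        f-inj {suc zero}    {suc zero}    _  = refl
        f-inj {suc zero}    {suc (suc j)} eq = contradiction (sym eq) (mz j)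
        f-inj {suc (suc i)} {zero}        eq = contradiction eq (my i)
        f-inj {suc (suc i)} {suc zero}    eq = contradiction eq (mz i)
        f-inj {suc (suc i)} {suc (suc j)} eq = cong (λ i → suc (suc i)) (rep-injective eq)

      Doubled : Fin (6 ℕ.+ k) → Set
      Doubled x = ∃₂ λ y i → Missed y × rep i ≡ x × Bag i y

      Defect : Fin (6 ℕ.+ k) → Set
      Defect x = Missed x ⊎ Doubled x

      doubled-unique : ∀ {x z} → Doubled x → Doubled z → x ≡ z
      doubled-unique (y , i , my , refl , b) (y′ , i′ , my′ , refl , b′) =
        cong rep (disjoint b (subst (Bag i′) (missed-unique my′ my) b′))

      check : ∀ x → Defect x ⊎ (∃[ i ] (Bag i x × (∀ {y} → Bag i y → y ≡ x)))
      check x with any? (λ i → rep i ≟ x)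
      ... | no miss = inj₁ (inj₁ (λ i eq → miss (i , eq)))
      ... | yes (i , refl) with any? (λ y → bag? i y ×-dec ¬? (y ≟ rep i))
      ...   | yes (y , b , ne) =
          inj₁ (inj₂ (y , i , (λ { j refl → ne (cong rep (disjoint (rep-bag j) b)) }) , refl , b))
      ...   | no alone = inj₂ (i , rep-bag i , single)
        where
        single : ∀ {y} → Bag i y → y ≡ rep i
        single {y} b with y ≟ rep i
        ... | yes eq = eq
        ... | no ne  = contradiction (y , b , ne) alone

      -- If both vertices were bags of their own, `touching` would make them adjacent.
      defect : ∀ {p q} → p ≢ q → ¬ ShareEndpoint p q → ∃[ x ] ((x ≡ p ⊎ x ≡ q) × Defect x)
      defect {p} {q} p≢q ¬share with check p | check q
      ... | inj₁ d | _      = p , inj₁ refl , d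
      ... | inj₂ _ | inj₁ d = q , inj₂ refl , d
      ... | inj₂ (i , bp , onlyp) | inj₂ (j , bq , onlyq) with touching {i} {j} (λ { refl → p≢q (onlyq bp) })
      ...   | x , y , bx , by , adj = contradiction (subst₂ ShareEndpoint (onlyp bx) (onlyq by) (L-adj⁻ H adj)) ¬share

      same-kind : ∀ {x y z} → Defect x → Defect y → Defect z → x ≡ y ⊎ x ≡ z ⊎ y ≡ z
      same-kind (inj₁ a) (inj₁ b) _        = inj₁ (missed-unique a b)
      same-kind (inj₂ a) (inj₂ b) _        = inj₁ (doubled-unique a b)
      same-kind (inj₁ a) (inj₂ b) (inj₁ c) = inj₂ (inj₁ (missed-unique a c))
      same-kind (inj₁ a) (inj₂ b) (inj₂ c) = inj₂ (inj₂ (doubled-unique b c))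
      same-kind (inj₂ a) (inj₁ b) (inj₁ c) = inj₂ (inj₂ (missed-unique b c))
      same-kind (inj₂ a) (inj₁ b) (inj₂ c) = inj₂ (inj₁ (doubled-unique a c))

    no-model : ⊥
    no-model with defect {0F} {5F} (λ ()) (λ (_ , p , q) → apart (λ ()) (λ ()) (λ ()) (λ ()) (flip p) (flip q))
                | defect {1F} {2F} (λ ()) (λ (_ , p , q) → apart (λ ()) (λ ()) (λ ()) (λ ()) (flip p) (flip q))
                | defect {3F} {4F} (λ ()) (λ (_ , p , q) → apart (λ ()) (λ ()) (λ ()) (λ ()) (flip p) (flip q))
      where
      flip : {A : Set} {a b x : A} → a ≡ x ⊎ b ≡ x → x ≡ a ⊎ x ≡ b
      flip = Sum.map sym sym
    ... | x , x∈ , dx | y , y∈ , dy | z , z∈ , dz with same-kind dx dy dz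
    ... | inj₁ refl        = apart (λ ()) (λ ()) (λ ()) (λ ()) x∈ y∈
    ... | inj₂ (inj₁ refl) = apart (λ ()) (λ ()) (λ ()) (λ ()) x∈ z∈
    ... | inj₂ (inj₂ refl) = apart (λ ()) (λ ()) (λ ()) (λ ()) y∈ z∈

thickK₄-example : ∀ k → ∃[ G ] (IsLineGraph G × KImmersion (5 ℕ.+ k) G × ¬ KMinor (5 ℕ.+ k) G)
thickK₄-example k = L H , isLineGraph H , immersion , λ m → no-model (minor⇒model m)
  where open ThickK₄ k

-- A line graph with a minor but no immersion

first-edge : ∀ {G x y} (p : Walk G x y) → x ≢ y → ∃₂ λ e z → Joins G e x z × e ∈ edges p
first-edge nil          x≢x = contradiction refl x≢x
first-edge (cons e j p) _   = e , _ , j , here refl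

-- The paths that leave `φ zero` begin with different edges, and in a simple graph these lead to
-- different neighbours.
immersion⇒degree : ∀ {n G} → Simple G → KImmersion (suc n) G →
                   ∃[ x ] Σ (Fin n → V G) λ y → Injective _≡_ _≡_ y × ∀ v → Adj G x (y v)
immersion⇒degree {n} {G} simple I = φ zero , (λ v → proj₁ (proj₂ (out v))) , injective ,
  λ v → let e , _ , j , _ = out v in e , j
  where
  open KImmersion I
  out : ∀ (v : Fin n) → ∃₂ λ e z → Joins G e (φ zero) z × e ∈ edges (Path.walk (path zero (suc v) (s≤s z≤n)))
  out v = first-edge (Path.walk (path zero (suc v) (s≤s z≤n))) (λ eq → contradiction (φInj eq) λ ())
  injective : ∀ {v w} → proj₁ (proj₂ (out v)) ≡ proj₁ (proj₂ (out w)) → v ≡ w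
  injective {v} {w} eq with v ≟ w
  ... | yes v≡w = v≡w
  ... | no v≢w = contradiction (m , subst (_∈ _) same m′)
                               (disjoint (s≤s z≤n) (s≤s z≤n) (λ eq′ → v≢w (Finₚ.suc-injective (proj₂ (,-injective eq′)))))
    where
    m  = proj₂ (proj₂ (proj₂ (out v)))
    m′ = proj₂ (proj₂ (proj₂ (out w)))
    same : proj₁ (out w) ≡ proj₁ (out v)
    same = simple (subst (Joins G _ _) (sym eq) (proj₁ (proj₂ (proj₂ (out w))))) (proj₁ (proj₂ (proj₂ (out v))))

module _ {a b c : ℕ} where
  abstract
    encode : Fin a × Fin b × Fin c → Fin (a ℕ.* (b ℕ.* c))
    encode (i , j , k) = combine i (combine j k)

    decode : Fin (a ℕ.* (b ℕ.* c)) → Fin a × Fin b × Fin c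
    decode x = let i , y = remQuot {a} (b ℕ.* c) x in i , remQuot {b} c y

    decode-encode : ∀ x → decode (encode x) ≡ x
    decode-encode (i , j , k) =
      trans (cong (λ (i , y) → i , remQuot {b} c y) (remQuot-combine {a} i (combine j k)))
            (cong (i ,_) (remQuot-combine {b} j k))

    encode-decode : ∀ x → encode (decode x) ≡ x
    encode-decode x = let i , y = remQuot {a} (b ℕ.* c) x in
      trans (cong (combine i) (combine-remQuot {b} c y)) (combine-remQuot {a} (b ℕ.* c) x)

  encode-injective : ∀ {x y} → encode x ≡ encode y → x ≡ y
  encode-injective {x} {y} eq = trans (sym (decode-encode x)) (trans (cong decode eq) (decode-encode y))

-- For every i < t a path through hubs (i , 0), …, (i , t-1), with a further
-- edge at each hub, where the edges at (i , j) and (j , i) meet.  All edges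
-- are subdivided: the edge (i , j , k) runs from the hub (i , j) to a vertex
-- of degree at most 2, on its left (k = 0), on its right (k = 1), or towards
-- the hub (j , i) (k = 2).
module Grid (n : ℕ) where

  private
    t : ℕ
    t = suc n

    -- The last coordinate of a `Node` is 0 for a hub, 1 for a joint on the path of a row, and 2 for
    -- the outer end of a further edge. A row has one more path joint than it has hubs, hence
    -- `suc t`.
    Triple Node : Set
    Triple = Fin t × Fin t × Fin 3
    Node   = Fin t × Fin (suc t) × Fin 3

    sort : ∀ {i j : Fin t} → Dec (i Fin.≤ j) → Fin t × Fin t
    sort {i} {j} (yes _) = i , j
    sort {i} {j} (no _)  = j , i

    upward : ∀ {i j : Fin t} → Dec (i Fin.≤ j) → Bool
    upward (yes _) = true
    upward (no _)  = false

    hub joint : Triple → Node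
    hub (i , j , _) = i , inject₁ j , 0F
    joint (i , j , 0F) = i , inject₁ j , 1F
    joint (i , j , 1F) = i , suc j , 1F
    joint (i , j , 2F) = let a , b = sort (i ≤? j) in a , inject₁ b , 2F

    -- Tells apart the edges that meet at a joint. Together with the joint it determines the edge,
    -- so at most two edges meet there.
    side : Triple → Bool
    side (_ , _ , 0F) = false
    side (_ , _ , 1F) = true
    side (i , j , 2F) = upward (i ≤? j)

    cross-injective : ∀ {i j i′ j′} (d : Dec (i Fin.≤ j)) (d′ : Dec (i′ Fin.≤ j′)) →
                      (let a , b = sort d ; a′ , b′ = sort d′ in (a , inject₁ b) ≡ (a′ , inject₁ b′)) →
                      upward d ≡ upward d′ → (Triple ∋ (i , j , 2F)) ≡ (i′ , j′ , 2F)
    cross-injective {i} (yes _) (yes _) p _ with ,-injective p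
    ... | refl , q = cong (λ j → i , j , 2F) (inject₁-injective q)
    cross-injective {j = j} (no _) (no _) p _ with ,-injective p
    ... | refl , q = cong (λ i → i , j , 2F) (inject₁-injective q)

    hub≢joint : ∀ x y → hub x ≢ joint y
    hub≢joint x (_ , _ , 0F) ()
    hub≢joint x (_ , _ , 1F) ()
    hub≢joint x (_ , _ , 2F) ()

    joint-side-injective : ∀ x y → joint x ≡ joint y → side x ≡ side y → x ≡ y
    joint-side-injective (i , j , 0F) (i′ , j′ , 0F) p _ with ,-injective p
    ... | refl , q = cong (λ j → i , j , 0F) (inject₁-injective (proj₁ (,-injective q)))
    joint-side-injective (i , j , 1F) (i′ , j′ , 1F) refl _ = refl
    joint-side-injective (i , j , 2F) (i′ , j′ , 2F) p s =
        cross-injective (i ≤? j) (i′ ≤? j′) (cong (λ (a , b , _) → a , b) p) s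
    joint-side-injective (i , j , 0F) (i′ , j′ , 1F) _ ()
    joint-side-injective (i , j , 1F) (i′ , j′ , 0F) _ ()
    joint-side-injective (i , j , 0F) (i′ , j′ , 2F) ()
    joint-side-injective (i , j , 1F) (i′ , j′ , 2F) ()
    joint-side-injective (i , j , 2F) (i′ , j′ , 0F) ()
    joint-side-injective (i , j , 2F) (i′ , j′ , 1F) ()

    hub-kind-injective : ∀ {x y} → hub x ≡ hub y → proj₂ (proj₂ x) ≡ proj₂ (proj₂ y) → x ≡ y
    hub-kind-injective {i , j , k} p refl with ,-injective p
    ... | refl , q = cong (λ j → i , j , k) (inject₁-injective (proj₁ (,-injective q)))

  H : Graph
  H = record
    { #V       = t ℕ.* (suc t ℕ.* 3)
    ; #E       = t ℕ.* (t ℕ.* 3)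
    ; ends     = λ e → encode (hub (decode e)) , encode (joint (decode e))
    ; loopless = λ e eq → hub≢joint (decode e) (decode e) (encode-injective {t} {suc t} {3} eq)
    }

  open Graph H using (ShareEndpoint)

  private
    dec : E H → Triple
    dec = decode

    dec-injective : ∀ {x y} → dec x ≡ dec y → x ≡ y
    dec-injective {x} {y} eq = trans (sym (encode-decode x)) (trans (cong encode eq) (encode-decode y))

    Close : Triple → Triple → Set
    Close x y = hub x ≡ hub y ⊎ joint x ≡ joint y

    share⇒close : ∀ {e f} → ShareEndpoint e f → Close (dec e) (dec f)
    share⇒close (_ , inj₁ p , inj₁ q) = inj₁ (encode-injective {t} {suc t} {3} (trans p (sym q)))
    share⇒close {e} {f} (_ , inj₁ p , inj₂ q) =
        contradiction (encode-injective {t} {suc t} {3} (trans p (sym q))) (hub≢joint (dec e) (dec f))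
    share⇒close {e} {f} (_ , inj₂ p , inj₁ q) =
        contradiction (encode-injective {t} {suc t} {3} (trans q (sym p))) (hub≢joint (dec f) (dec e))
    share⇒close (_ , inj₂ p , inj₂ q) = inj₂ (encode-injective {t} {suc t} {3} (trans p (sym q)))

    close⇒share : ∀ {e f} → Close (dec e) (dec f) → ShareEndpoint e f
    close⇒share (inj₁ p) = _ , inj₁ refl , inj₁ (cong encode (sym p))
    close⇒share (inj₂ p) = _ , inj₂ refl , inj₂ (cong encode (sym p))

    kind : Triple → Fin 3
    kind (_ , _ , k) = k

    -- The (at most) three neighbours of x: two at its hub and one at its joint.
    slot : ∀ x y → x ≢ y → Close x y → Fin 3
    slot x y x≢y (inj₁ p) = suc (punchOut {i = kind x} {kind y} (λ eq → x≢y (hub-kind-injective p eq)))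
    slot x y x≢y (inj₂ p) = zero

    slot-injective : ∀ {x y z} (p : x ≢ y) (c : Close x y) (q : x ≢ z) (d : Close x z) → slot x y p c ≡ slot x z q d → y ≡ z
    slot-injective p (inj₁ c) q (inj₁ d) eq =
      hub-kind-injective (trans (sym c) d)
        (punchOut-injective (λ eq → p (hub-kind-injective c eq)) (λ eq → q (hub-kind-injective d eq)) (Finₚ.suc-injective eq))
    -- A neighbour at the joint is on the side opposite to `x`, so two such neighbours agree in
    -- joint and side.
    slot-injective {x} {y} {z} p (inj₂ c) q (inj₂ d) eq =
      joint-side-injective y z (trans (sym c) d)
        (trans (Boolₚ.¬-not (λ s → p (joint-side-injective x y c (sym s))))
               (sym (Boolₚ.¬-not (λ s → q (joint-side-injective x z d (sym s))))))

  private
    degree≤3 : ∀ {m} x (y : Fin (4 ℕ.+ m) → E H) → Injective _≡_ _≡_ y →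
               (∀ v → dec x ≢ dec (y v)) → (∀ v → Close (dec x) (dec (y v))) → ⊥
    degree≤3 {m} x y y-inj ≢v close =
      let v , w , v<w , eq = pigeonhole {3} {4 ℕ.+ m} (s≤s (s≤s (s≤s (s≤s z≤n))))
                               (λ v → slot (dec x) (dec (y v)) (≢v v) (close v))
      in <⇒≢ v<w (y-inj (dec-injective (slot-injective (≢v v) (close v) (≢v w) (close w) eq)))

  no-immersion : ∀ m → ¬ KImmersion (5 ℕ.+ m) (L H)
  no-immersion m I = crowded (immersion⇒degree (simpleGraph-simple (Graph.shareEndpoint? H)) I)
    where
    crowded : ¬ (∃[ x ] Σ (Fin (4 ℕ.+ m) → E H) λ y → Injective _≡_ _≡_ y × ∀ v → Adj (L H) x (y v))
    crowded (x , y , y-inj , adj) =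
      degree≤3 x y y-inj (λ v eq → joins-≢ (L H) {proj₁ (adj v)} (proj₂ (adj v)) (dec-injective eq))
                         (λ v → share⇒close {x} {y v} (L-adj⁻ H (adj v)))

  private
    Row : Fin t → E H → Set
    Row i e = proj₁ (dec e) ≡ i

    InRow : Fin t → Rel (E H) _
    InRow i e f = Row i e × Row i f × Adj (L H) e f

    enc : Triple → E H
    enc = encode

    dec-enc : ∀ x → dec (enc x) ≡ x
    dec-enc = decode-encode

    step : ∀ {i j k j′ k′} → Close (i , j , k) (i , j′ , k′) → Star (InRow i) (enc (i , j , k)) (enc (i , j′ , k′))
    step {i} {j} {k} {j′} {k′} c = go (enc (i , j , k) ≟ enc (i , j′ , k′))
      where
      go : Dec (enc (i , j , k) ≡ enc (i , j′ , k′)) → Star (InRow i) (enc (i , j , k)) (enc (i , j′ , k′))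
      -- `Close` is reflexive but adjacency is not, so a step from an edge to itself becomes the
      -- empty walk.
      go (yes eq) = subst (Star (InRow i) _) eq ε
      go (no ne)  = (cong proj₁ (dec-enc _) , cong proj₁ (dec-enc _) ,
                     L-adj H ne (close⇒share (subst₂ Close (sym (dec-enc _)) (sym (dec-enc _)) c))) ◅ ε

    InRow-sym : ∀ {i e f} → InRow i e f → InRow i f e
    InRow-sym (p , q , a) = q , p , adj-sym (L H) a

    -- Rightwards along the row: from the left edge of a hub to its right edge, then across the
    -- joint to the left edge of the next hub.
    leftmost : ∀ i j → Star (InRow i) (enc (i , zero , 0F)) (enc (i , j , 0F))
    leftmost i = <-weakInduction (λ j → Star (InRow i) (enc (i , zero , 0F)) (enc (i , j , 0F))) ε
      (λ j s → s ◅◅ step {i} {inject₁ j} {0F} {inject₁ j} {1F} (inj₁ refl) ◅◅ step {i} {inject₁ j} {1F} {suc j} {0F} (inj₂ refl))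

    row-start : ∀ i {e} → Row i e → Star (InRow i) (enc (i , zero , 0F)) e
    row-start i {e} p = subst (Star (InRow i) (enc (i , zero , 0F)))
                              (trans (cong (λ i → enc (i , j , k)) (sym p)) (encode-decode e))
                              (leftmost i j ◅◅ step {i} {j} {0F} {j} {k} (inj₁ refl))
      where
      j : Fin t
      j = proj₁ (proj₂ (dec e))
      k : Fin 3
      k = kind (dec e)

    joint-sym : ∀ i j → i ≢ j → joint (i , j , 2F) ≡ joint (j , i , 2F)
    joint-sym i j i≢j with i ≤? j | j ≤? i
    ... | yes p | yes q = contradiction (≤-antisym p q) i≢j
    ... | yes _ | no _  = refl
    ... | no _  | yes _ = refl
    ... | no p  | no q  = contradiction (≤-total i j) [ p , q ]

  model : Model t (L H)
  model = record
    { Bag       = Row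
    ; bag?      = λ i e → proj₁ (dec e) ≟ i
    ; disjoint  = λ { refl refl → refl }
    ; nonempty  = λ i → enc (i , zero , 0F) , cong proj₁ (dec-enc _)
    ; connected = λ i p q → Star.reverse InRow-sym (row-start i p) ◅◅ row-start i q
    ; touching  = λ {i} {j} i≢j → enc (i , j , 2F) , enc (j , i , 2F) , cong proj₁ (dec-enc _) , cong proj₁ (dec-enc _) ,
        L-adj H (λ eq → i≢j (cong proj₁ (encode-injective {t} {t} {3} eq)))
                (close⇒share (subst₂ Close (sym (dec-enc _)) (sym (dec-enc _)) (inj₂ (joint-sym i j i≢j))))
    }

grid-example : ∀ k → ∃[ G ] (IsLineGraph G × KMinor (5 ℕ.+ k) G × ¬ KImmersion (5 ℕ.+ k) G)
grid-example k = L H , isLineGraph H , model⇒minor model , no-immersion k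
  where open Grid (4 ℕ.+ k)

-- Models in line graphs

-- Edges of `L H` are indices into a list; here an isomorphism with `L H` is reduced to adjacency
-- and simplicity, so that later arguments speak of edges of `H` only.
record LineRep (G H : Graph) : Set where
  open Graph H using (ShareEndpoint)
  field
    ψ           : V G → E H
    ψ⁻¹         : E H → V G
    ψ-inverse   : ∀ e → ψ (ψ⁻¹ e) ≡ e
    ψ-injective : ∀ {x y} → ψ x ≡ ψ y → x ≡ y
    simple      : Simple G
    share       : ∀ {e x y} → Joins G e x y → ShareEndpoint (ψ x) (ψ y)
    adjacent    : ∀ {x y} → x ≢ y → ShareEndpoint (ψ x) (ψ y) → Adj G x y

lineRep : ∀ {G H} → G ≅ L H → LineRep G H
lineRep {G} {H} iso = record
  { ψ           = to onV
  ; ψ⁻¹         = from onV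
  ; ψ-inverse   = strictlyInverseˡ onV
  ; ψ-injective = injectiveV
  ; simple      = λ {e} {f} {x} {y} p q → injectiveE
      (simpleGraph-simple share? {to onE e} {to onE f} {to onV x} {to onV y} (joins p) (joins q))
  ; share       = λ {e} {x} {y} j → simpleGraph-related share? (share-sym H) {to onE e} {to onV x} {to onV y} (joins j)
  ; adjacent    = λ x≢y s → pull (Collapse.lift (≅⇒collapse iso) (simpleGraph-adj share? (share-sym H) (x≢y ∘ injectiveV) s))
  }
  where
  open _≅_ iso
  open Inverse
  share? = Graph.shareEndpoint? H
  injectiveV : ∀ {x y} → to onV x ≡ to onV y → x ≡ y
  injectiveV {x} {y} eq = trans (sym (strictlyInverseʳ onV x)) (trans (cong (from onV) eq) (strictlyInverseʳ onV y))
  injectiveE : ∀ {x y} → to onE x ≡ to onE y → x ≡ y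
  injectiveE {x} {y} eq = trans (sym (strictlyInverseʳ onE x)) (trans (cong (from onE) eq) (strictlyInverseʳ onE y))
  pull : ∀ {x y} → (∃₂ λ a b → to onV a ≡ to onV x × to onV b ≡ to onV y × Adj G a b) → Adj G x y
  pull (a , b , p , q , adj) = subst₂ (Adj G) (injectiveV p) (injectiveV q) adj

allPairs-lookup : {A : Set} {R : Rel A 0ℓ} {xs : List A} → AllPairs R xs → ∀ {i j} → i < j → R (lookup xs i) (lookup xs j)
allPairs-lookup {xs = x ∷ xs} (r ∷ _) {zero}  {suc j} _         = All.lookup r (∈-lookup {xs = xs} j)
allPairs-lookup {xs = x ∷ xs} (_ ∷ p) {suc i} {suc j} (s≤s i<j) = allPairs-lookup p i<j

-- `T` will be adjacency in the graph itself, or sharing an endpoint among the edges of `H`; the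
-- latter is reflexive.
module Bags {n : ℕ} (T : Rel (Fin n) 0ℓ) where

  In : List (Fin n) → Rel (Fin n) 0ℓ
  In l a b = a ∈ l × b ∈ l × T a b

  Connected : List (Fin n) → Set
  Connected l = ∃ (_∈ l) × (∀ {a b} → a ∈ l → b ∈ l → Star (In l) a b)

  Meet : Rel (List (Fin n)) 0ℓ
  Meet l m = Disjoint l m × ∃₂ λ a b → a ∈ l × b ∈ m × T a b

  connected-[_] : ∀ a → Connected (a ∷ [])
  connected-[ a ] = (a , here refl) , λ { (here refl) (here refl) → ε }

  connected-from : ∀ {a l} → Symmetric T → a ∈ l → (∀ {b} → b ∈ l → Star (In l) a b) → Connected l
  connected-from T-sym a∈ s = (_ , a∈) , λ p q → Star.reverse (λ (x , y , t) → y , x , T-sym t) (s p) ◅◅ s q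

  bags⇒model : (G : Graph) (ρ : V G → Fin n) (ρ⁻¹ : Fin n → V G) → (∀ a → ρ (ρ⁻¹ a) ≡ a) → Injective _≡_ _≡_ ρ →
               (∀ {x y} → x ≢ y → T (ρ x) (ρ y) → Adj G x y) →
               (ls : List (List (Fin n))) → All Connected ls → AllPairs Meet ls → Model (length ls) G
  bags⇒model G ρ ρ⁻¹ inv ρ-inj adj ls conn meet = record
    { Bag       = Bag
    ; bag?      = λ i x → ρ x ∈? lookup ls i
    ; disjoint  = λ {i} {j} → disjoint {i} {j}
    ; nonempty  = λ i → let a , a∈ = proj₁ (conn′ i) in ρ⁻¹ a , subst (_∈ lookup ls i) (sym (inv a)) a∈
    ; connected = λ i p q → pull {i} (proj₂ (conn′ i) p q) refl refl
    ; touching  = touching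
    }
    where
    open DecMembership (_≟_ {n}) using (_∈?_)
    Bag : Fin (length ls) → V G → Set
    Bag i x = ρ x ∈ lookup ls i
    conn′ : ∀ i → Connected (lookup ls i)
    conn′ i = All.lookup conn (∈-lookup {xs = ls} i)
    disjoint : ∀ {i j x} → Bag i x → Bag j x → i ≡ j
    disjoint {i} {j} p q with <-cmp i j
    ... | tri< i<j _ _ = contradiction (p , q) (proj₁ (allPairs-lookup meet i<j))
    ... | tri≈ _ i≡j _ = i≡j
    ... | tri> _ _ j<i = contradiction (q , p) (proj₁ (allPairs-lookup meet j<i))
    adj′ : ∀ {a b} → a ≢ b → T a b → Adj G (ρ⁻¹ a) (ρ⁻¹ b)
    adj′ {a} {b} a≢b t =
        adj (λ eq → a≢b (trans (sym (inv a)) (trans (cong ρ eq) (inv b)))) (subst₂ T (sym (inv a)) (sym (inv b)) t)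
    pull : ∀ {i a b x y} → Star (In (lookup ls i)) a b → ρ x ≡ a → ρ y ≡ b → Star (λ x y → Bag i x × Bag i y × Adj G x y) x y
    pull ε p q = subst (Star _ _) (ρ-inj (trans p (sym q))) ε
    -- Since `T` may be reflexive, a step from an element to itself has no edge behind it and is
    -- skipped.
    pull {i} {x = x} (_◅_ {j = c} (a∈ , c∈ , t) s) p q with ρ x ≟ c
    ... | yes eq = pull {i} s eq q
    ... | no ne  = (subst (_∈ lookup ls i) (sym p) a∈ , subst (_∈ lookup ls i) (sym (inv c)) c∈ ,
                    adj (λ eq → ne (trans (cong ρ eq) (inv c))) (subst₂ T (sym p) (sym (inv c)) t)) ◅ pull {i} s (inv c) q
    meeting : ∀ {i j} → i < j → ∃₂ λ x y → Bag i x × Bag j y × Adj G x y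
    meeting {i} {j} i<j = let disj , a , b , a∈ , b∈ , t = allPairs-lookup meet i<j in
      ρ⁻¹ a , ρ⁻¹ b , subst (_∈ lookup ls i) (sym (inv a)) a∈ , subst (_∈ lookup ls j) (sym (inv b)) b∈ ,
      adj′ (λ eq → disj (a∈ , subst (_∈ lookup ls j) (sym eq) b∈)) t
    touching : ∀ {i j} → i ≢ j → ∃₂ λ x y → Bag i x × Bag j y × Adj G x y
    touching {i} {j} i≢j with <-cmp i j
    ... | tri< i<j _ _ = meeting i<j
    ... | tri≈ _ i≡j _ = contradiction i≡j i≢j
    ... | tri> _ _ j<i = let x , y , p , q , a = meeting j<i in y , x , q , p , adj-sym G a

-- Small models: edges, cycles, stars and thetas

module _ {G : Graph} where
  open Bags (Adj G)

  vertexBags⇒model : (ls : List (List (V G))) → All Connected ls → AllPairs Meet ls → Model (length ls) G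
  vertexBags⇒model = bags⇒model G id id (λ _ → refl) id (λ _ a → a)

  vertices-connected : ∀ {x y} (p : Walk G x y) → Connected (vertices p)
  vertices-connected p = connected-from (adj-sym G) (start-∈ p) (reach p)
    where
    reach : ∀ {x y b} (p : Walk G x y) → b ∈ vertices p → Star (In (vertices p)) x b
    reach nil          (here refl) = ε
    reach (cons e j p) (here refl) = ε
    reach (cons e j p) (there m)   =
      (here refl , there (start-∈ p) , e , j) ◅ Star.map (λ (a , b , t) → there a , there b , t) (reach p m)

  immersion⇒model₁ : KImmersion 1 G → Model 1 G
  immersion⇒model₁ I = vertexBags⇒model ((KImmersion.φ I zero ∷ []) ∷ []) (connected-[ _ ] ∷ []) ([] ∷ [])

  edge⇒model : ∀ {e x y} → Joins G e x y → Model 2 G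
  edge⇒model {e} {x} {y} j =
    vertexBags⇒model ((x ∷ []) ∷ (y ∷ []) ∷ []) (connected-[ _ ] ∷ connected-[ _ ] ∷ [])
      ((((λ { (here refl , here refl) → joins-≢ G {e} j refl }) , _ , _ , here refl , here refl , e , j) ∷ []) ∷ ([] ∷ []))

  immersion⇒model₂ : KImmersion 2 G → Model 2 G
  immersion⇒model₂ I =
    let e , _ , j , _ = first-edge (Path.walk (path 0F 1F (s≤s z≤n))) (λ eq → contradiction (φInj eq) λ ())
    in edge⇒model {e} j
    where open KImmersion I

  -- Simplicity excludes a path of length one, which would be parallel to `e`. On the cycle closed
  -- by a longer path the bags are its first two vertices and the rest.
  cycle⇒model : ∀ {e x y} → Simple G → Joins G e x y → (q : Path G y x) → e ∉ edges (Path.walk q) → Model 3 G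
  cycle⇒model {e} simple j record { walk = nil } _ = contradiction refl (joins-≢ G {e} j)
  cycle⇒model {e} simple j record { walk = cons e₁ j₁ nil } e∉ =
    contradiction (here (simple j (joins-sym G {e₁} j₁))) e∉
  cycle⇒model {e} {x} {y} simple j record { walk = cons {y = z} e₁ j₁ (cons e₂ j₂ p) ; simple = y∉ ∷ z∉ ∷ _ } _ =
    vertexBags⇒model ((y ∷ []) ∷ (z ∷ []) ∷ vertices p ∷ []) (connected-[ _ ] ∷ connected-[ _ ] ∷ vertices-connected p ∷ [])
      ( (((λ { (here refl , here refl) → joins-≢ G {e₁} j₁ refl }) , _ , _ , here refl , here refl , e₁ , j₁)
        ∷ ((λ { (here refl , m) → All.lookup y∉ (there m) refl }) , _ , _ , here refl , end-∈ p , e , joins-sym G {e} j) ∷ [])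
      ∷ (((λ { (here refl , m) → All.lookup z∉ m refl }) , _ , _ , here refl , start-∈ p , e₂ , j₂) ∷ [])
      ∷ [] ∷ [])

  -- The first edge of `p` occurs only once on the closed walk, so the remainder can be shortened to
  -- a path that avoids it.
  closedWalk⇒model : ∀ {x y} → Simple G → x ≢ y → (p : Path G x y) (q : Walk G y x) →
                     Disjoint (edges (Path.walk p)) (edges q) → Model 3 G
  closedWalk⇒model _ ne record { walk = nil } _ _ = contradiction refl ne
  closedWalk⇒model simple _ record { walk = cons e j p ; simple = u } q p∩q with simple⇒unique-edges (cons e j p) u
  ... | e∉p ∷ _ = cycle⇒model {e} simple j path avoids
    where
    open Shortening (shorten (p ⟫ q))
    avoids : e ∉ edges (Path.walk path)
    avoids m with ∈-⟫⁻ p q (fewer m)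
    ... | inj₁ m₁ = All.lookup e∉p m₁ refl
    ... | inj₂ m₂ = p∩q (here refl , m₂)

  immersion⇒model₃ : Simple G → KImmersion 3 G → Model 3 G
  immersion⇒model₃ simple I = closedWalk⇒model simple (λ eq → contradiction (φInj eq) λ ()) (path 0F 1F 0<1) back avoids
    where
    open KImmersion I
    0<1 : _<_ {3} {3} 0F 1F
    0<1 = s≤s z≤n
    0<2 : _<_ {3} {3} 0F 2F
    0<2 = s≤s z≤n
    1<2 : _<_ {3} {3} 1F 2F
    1<2 = s≤s (s≤s z≤n)
    back : Walk G (φ 1F) (φ 0F)
    back = Path.walk (path 1F 2F 1<2) ⟫ rev (Path.walk (path 0F 2F 0<2))
    avoids : Disjoint (edges (Path.walk (path 0F 1F 0<1))) (edges back)
    avoids (m , m′) with ∈-⟫⁻ (Path.walk (path 1F 2F 1<2)) _ m′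
    ... | inj₁ n = disjoint 0<1 1<2 (λ ()) (m , n)
    ... | inj₂ n = disjoint 0<1 0<2 (λ ()) (m , ∈-rev⁻ (Path.walk (path 0F 2F 0<2)) n)

FourAt : (H : Graph) → V H → Set
FourAt H c = ∃₂ λ a b → ∃₂ λ d e → Unique (a ∷ b ∷ d ∷ e ∷ []) × All (λ f → Graph.Endpoint H f c) (a ∷ b ∷ d ∷ e ∷ [])

module _ {G H : Graph} (rep : LineRep G H) where
  open LineRep rep
  open Graph H using (Endpoint; ShareEndpoint)
  open Bags ShareEndpoint

  edgeBags⇒model : (ls : List (List (E H))) → All Connected ls → AllPairs Meet ls → Model (length ls) G
  edgeBags⇒model = bags⇒model G ψ ψ⁻¹ ψ-inverse ψ-injective adjacent

  edges-connected : ∀ {x y z} e (j : Joins H e x y) (p : Walk H y z) → Connected (edges (cons e j p))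
  edges-connected e j p = connected-from (share-sym H) (here refl) (reach e j p)
    where
    reach : ∀ {x y z f} e (j : Joins H e x y) (p : Walk H y z) → f ∈ edges (cons e j p) → Star (In (edges (cons e j p))) e f
    reach e j p             (here refl) = ε
    reach e j (cons e′ j′ p) (there m)  =
      (here refl , there (here refl) , _ , joins⇒endpointʳ H {e} j , joins⇒endpointˡ H {e′} j′)
      ◅ Star.map (λ (a , b , t) → there a , there b , t) (reach e′ j′ p m)

  last-edge : ∀ {x y z} e (j : Joins H e x y) (p : Walk H y z) → ∃[ f ] (f ∈ edges (cons e j p) × Endpoint f z)
  last-edge e j nil            = e , here refl , joins⇒endpointʳ H {e} j
  last-edge e j (cons e′ j′ p) = let f , m , q = last-edge e′ j′ p in f , there m , q

  fourAt⇒model : ∀ {c} → FourAt H c → Model 4 G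
  fourAt⇒model {c} (a , b , d , e , (a≢b ∷ a≢d ∷ a≢e ∷ []) ∷ (b≢d ∷ b≢e ∷ []) ∷ (d≢e ∷ []) ∷ _ , pa ∷ pb ∷ pd ∷ pe ∷ []) =
    edgeBags⇒model ((a ∷ []) ∷ (b ∷ []) ∷ (d ∷ []) ∷ (e ∷ []) ∷ [])
      (connected-[ a ] ∷ connected-[ b ] ∷ connected-[ d ] ∷ connected-[ e ] ∷ [])
      ((meet pa pb a≢b ∷ meet pa pd a≢d ∷ meet pa pe a≢e ∷ [])
        ∷ (meet pb pd b≢d ∷ meet pb pe b≢e ∷ []) ∷ (meet pd pe d≢e ∷ []) ∷ [] ∷ [])
    where
    meet : ∀ {f g} → Endpoint f c → Endpoint g c → f ≢ g → Meet (f ∷ []) (g ∷ [])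
    meet p q f≢g = (λ { (here refl , here refl) → f≢g refl }) , _ , _ , here refl , here refl , c , p , q

  -- Of three edge-disjoint s-t-walks, one of length at least two is split
  -- after its first edge; this gives four connected, pairwise touching sets.
  theta⇒model : ∀ {s t} → s ≢ t → (p q r : Walk H s t) → Unique (edges p) →
                Disjoint (edges p) (edges q) → Disjoint (edges p) (edges r) → Disjoint (edges q) (edges r) →
                Model 4 G ⊎ (∃[ e ] (edges p ≡ e ∷ [] × Joins H e s t))
  theta⇒model s≢t nil _ _ _ _ _ _ = contradiction refl s≢t
  theta⇒model s≢t _ nil _ _ _ _ _ = contradiction refl s≢t
  theta⇒model s≢t _ _ nil _ _ _ _ = contradiction refl s≢t
  theta⇒model s≢t (cons e j nil) _ _ _ _ _ _ = inj₂ (e , refl , j)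
  theta⇒model {s} {t} s≢t (cons e j (cons e′ j′ p)) (cons f k q) (cons g l r) (e∉ ∷ _) pq pr qr =
    inj₁ (edgeBags⇒model ((e ∷ []) ∷ edges (cons e′ j′ p) ∷ edges (cons f k q) ∷ edges (cons g l r) ∷ [])
      (connected-[ e ] ∷ edges-connected e′ j′ p ∷ edges-connected f k q ∷ edges-connected g l r ∷ [])
      ( (((λ { (here refl , m) → All.lookup e∉ m refl }) , _ , _ , here refl , here refl ,
           _ , joins⇒endpointʳ H {e} j , joins⇒endpointˡ H {e′} j′)
        ∷ ((λ { (here refl , m) → pq (here refl , m) }) , _ , _ , here refl , here refl ,
           s , joins⇒endpointˡ H {e} j , joins⇒endpointˡ H {f} k)
        ∷ ((λ { (here refl , m) → pr (here refl , m) }) , _ , _ , here refl , here refl ,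
           s , joins⇒endpointˡ H {e} j , joins⇒endpointˡ H {g} l)
        ∷ [])
      ∷ (((λ { (m , m′) → pq (there m , m′) }) , last-meet (last-edge e′ j′ p) (last-edge f k q))
        ∷ ((λ { (m , m′) → pr (there m , m′) }) , last-meet (last-edge e′ j′ p) (last-edge g l r))
        ∷ [])
      ∷ ((qr , _ , _ , here refl , here refl , s , joins⇒endpointˡ H {f} k , joins⇒endpointˡ H {g} l) ∷ [])
      ∷ [] ∷ []))
    where
    last-meet : ∀ {l m} → ∃[ a ] (a ∈ l × Endpoint a t) → ∃[ b ] (b ∈ m × Endpoint b t) →
                ∃₂ λ a b → a ∈ l × b ∈ m × ShareEndpoint a b
    last-meet (a , a∈ , p) (b , b∈ , q) = a , b , a∈ , b∈ , t , p , q

-- Cuts in line graphs of subcubic graphs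

Same : {A : Set} → A × A → A × A → Set
Same (a , b) (c , d) = (a ≡ c × b ≡ d) ⊎ (a ≡ d × b ≡ c)

same? : ∀ {n} (p q : Fin n × Fin n) → Dec (Same p q)
same? (a , b) (c , d) = ((a ≟ c) ×-dec (b ≟ d)) ⊎-dec ((a ≟ d) ×-dec (b ≟ c))

-- A K₄-immersion without its walks: Link a b holds of the edges of the path
-- between the branch vertices a and b, which only enter through cuts.
record Linkage (G : Graph) : Set₁ where
  field
    φ         : Fin 4 → V G
    injective : ∀ {a b} → φ a ≡ φ b → a ≡ b
    Link      : Fin 4 → Fin 4 → E G → Set
    exclusive : ∀ {a b c d e} → Link a b e → Link c d e → Same (a , b) (c , d)
    crosses   : ∀ {a b} (h : V G → Bool) → h (φ a) ≢ h (φ b) →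
                ∃[ e ] (Link a b e × ∃₂ λ x y → Joins G e x y × h x ≡ true × h y ≡ false)

walk-crosses : ∀ {G x y} (h : V G → Bool) (p : Walk G x y) → h x ≢ h y →
               ∃[ e ] (e ∈ edges p × ∃₂ λ a b → Joins G e a b × h a ≡ true × h b ≡ false)
walk-crosses h nil ne = contradiction refl ne
walk-crosses {G} {x} h (cons {y = z} e j p) ne with h x in hx | h z in hz
... | true  | false = e , here refl , _ , _ , j , hx , hz
... | false | true  = e , here refl , _ , _ , joins-sym G {e} j , hz , hx
... | true  | true  = let f , m , r = walk-crosses h p (λ eq → ne (trans (sym hz) eq)) in f , there m , r
... | false | false = let f , m , r = walk-crosses h p (λ eq → ne (trans (sym hz) eq)) in f , there m , r

immersion⇒linkage : ∀ {G} → KImmersion 4 G → Linkage G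
immersion⇒linkage {G} I = record
  { φ         = φ
  ; injective = φInj
  ; Link      = Link
  ; exclusive = exclusive
  ; crosses   = crosses
  }
  where
  open KImmersion I
  On : Fin 4 → Fin 4 → E G → Set
  On u v e = Σ (u < v) λ u<v → e ∈ edges (Path.walk (path u v u<v))
  Link : Fin 4 → Fin 4 → E G → Set
  Link a b e = On a b e ⊎ On b a e
  on-unique : ∀ {a b c d e} → On a b e → On c d e → a ≡ c × b ≡ d
  on-unique {a} {b} {c} {d} (p , m) (q , n) with (a ≟ c) ×-dec (b ≟ d)
  ... | yes eq = eq
  ... | no ne  = contradiction (m , n) (disjoint p q (λ eq → ne (,-injective eq)))
  exclusive : ∀ {a b c d e} → Link a b e → Link c d e → Same (a , b) (c , d)
  exclusive (inj₁ p) (inj₁ q) = inj₁ (on-unique p q)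
  exclusive (inj₁ p) (inj₂ q) = inj₂ (on-unique p q)
  exclusive (inj₂ p) (inj₁ q) = inj₂ (let x , y = on-unique p q in y , x)
  exclusive (inj₂ p) (inj₂ q) = inj₁ (let x , y = on-unique p q in y , x)
  crosses : ∀ {a b} (h : V G → Bool) → h (φ a) ≢ h (φ b) →
            ∃[ e ] (Link a b e × ∃₂ λ x y → Joins G e x y × h x ≡ true × h y ≡ false)
  crosses {a} {b} h ne with <-cmp a b
  ... | tri< a<b _ _  = let e , m , r = walk-crosses h (Path.walk (path a b a<b)) ne in e , inj₁ (a<b , m) , r
  ... | tri≈ _ refl _ = contradiction refl ne
  ... | tri> _ _ b<a  = let e , m , r = walk-crosses h (Path.walk (path b a b<a)) (≢-sym ne) in e , inj₂ (b<a , m) , r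

-- For numbering the branch vertices in their order along the cycle. A `KImmersion` has paths for
-- `u < v` only and would need some of them reversed; `crosses` holds for either order of a pair.
reindex : ∀ {G} (σ : Fin 4 → Fin 4) → (∀ a b → σ a ≡ σ b → a ≡ b) → Linkage G → Linkage G
reindex σ inj Λ = record
  { φ         = φ ∘ σ
  ; injective = λ eq → inj _ _ (injective eq)
  ; Link      = λ a b → Link (σ a) (σ b)
  ; exclusive = λ p q → Sum.map (λ (x , y) → inj _ _ x , inj _ _ y) (λ (x , y) → inj _ _ x , inj _ _ y) (exclusive p q)
  ; crosses   = crosses
  }
  where open Linkage Λ

cyclic : Fin 4 → Fin 4
cyclic 0F = 1F
cyclic 1F = 2F
cyclic 2F = 3F
cyclic 3F = 0F

-- The labels on the arc from label k + 1 to label l of the 4-cycle.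
arc : Fin 4 → Fin 4 → Fin 4 → Bool
arc k l n = (toℕ k ℕ.<ᵇ toℕ n) ∧ (toℕ n ℕ.≤ᵇ toℕ l)

abstract
  others : ∀ (a b : Fin 4) → ∃₂ λ c d → c ≢ a × c ≢ b × d ≢ a × d ≢ b × d ≢ c
  others = from-yes (all? {4} λ a → all? {4} λ b → any? {4} λ c → any? {4} λ d →
    ¬? (c ≟ a) ×-dec ¬? (c ≟ b) ×-dec ¬? (d ≟ a) ×-dec ¬? (d ≟ b) ×-dec ¬? (d ≟ c))

  arc-boundary : ∀ k l m → arc k l m ≢ arc k l (cyclic m) → m ≡ k ⊎ m ≡ l
  arc-boundary = from-yes (all? {4} λ k → all? {4} λ l → all? {4} λ m →
    ¬? (arc k l m Boolₚ.≟ arc k l (cyclic m)) →-dec ((m ≟ k) ⊎-dec (m ≟ l)))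

  cyclic-≢ : ∀ m → cyclic m ≢ m
  cyclic-≢ = from-yes (all? {4} λ m → ¬? (cyclic m ≟ m))

module Subcubic {G H : Graph} (rep : LineRep G H) (subcubic : ∀ c → ¬ FourAt H c) where
  open LineRep rep
  open Graph H using (Endpoint)

  private
    four : ∀ {c a b d e} → Endpoint a c → Endpoint b c → Endpoint d c → Endpoint e c →
           a ≢ b → a ≢ d → a ≢ e → b ≢ d → b ≢ e → d ≢ e → ⊥
    four {c} pa pb pd pe ab ad ae bd be de =
      subcubic c (_ , _ , _ , _ , (ab ∷ ad ∷ ae ∷ []) ∷ (bd ∷ be ∷ []) ∷ (de ∷ []) ∷ [] ∷ [] , pa ∷ pb ∷ pd ∷ pe ∷ [])

  record Crossing (g : E H → Bool) (w : V H) (e : E G) : Set where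
    constructor crossing
    field
      {x y} : V G
      joins : Joins G e x y
      gx    : g (ψ x) ≡ true
      gy    : g (ψ y) ≡ false
      wx    : Endpoint (ψ x) w
      wy    : Endpoint (ψ y) w

  private
    tf : ∀ {g : E H → Bool} {a b} → g a ≡ true → g b ≡ false → a ≢ b
    tf p q refl with () ← trans (sym p) q

    parallel : ∀ {g w e₁ e₂} (c₁ : Crossing g w e₁) (c₂ : Crossing g w e₂) → e₁ ≢ e₂ →
               Crossing.x c₁ ≡ Crossing.x c₂ → ψ (Crossing.y c₁) ≢ ψ (Crossing.y c₂)
    parallel (crossing {x} j _ _ _ _) (crossing j′ _ _ _ _) ne refl eq with ψ-injective eq
    ... | refl = ne (simple j j′)

    -- Two different true edges and two different false edges would be four edges at `w`.
    square : ∀ {g w e₁ e₂ e₃ e₄} (c₁ : Crossing g w e₁) (c₂ : Crossing g w e₂) (c₃ : Crossing g w e₃) (c₄ : Crossing g w e₄) →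
             Crossing.x c₁ ≢ Crossing.x c₂ → Crossing.y c₃ ≡ Crossing.y c₄
    square {g} c₁ c₂ c₃ c₄ ne with y c₃ ≟ y c₄
      where open Crossing
    ... | yes eq = eq
    ... | no ne′ = ⊥-elim (four (wx c₁) (wx c₂) (wy c₃) (wy c₄) (ne ∘ ψ-injective)
                     (tf {g} (gx c₁) (gy c₃)) (tf {g} (gx c₁) (gy c₄)) (tf {g} (gx c₂) (gy c₃))
                     (tf {g} (gx c₂) (gy c₄)) (ne′ ∘ ψ-injective))
      where open Crossing

    -- By `square`, two true edges force all crossings to share one false edge. By simplicity their
    -- true edges then differ, and with the false one these are four edges at `w`.
    fan : ∀ {g w e₁ e₂ e₃} (c₁ : Crossing g w e₁) (c₂ : Crossing g w e₂) (c₃ : Crossing g w e₃) →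
          e₁ ≢ e₂ → e₁ ≢ e₃ → e₂ ≢ e₃ → Crossing.x c₁ ≢ Crossing.x c₂ → ⊥
    fan {g} c₁@(crossing {x₁} {y} j₁ g₁ h₁ p₁ q₁) c₂@(crossing {x₂} j₂ g₂ _ p₂ _) c₃@(crossing {x₃} j₃ g₃ _ p₃ _) n₁₂ n₁₃ n₂₃ ne
      with square c₁ c₂ c₁ c₂ ne | square c₁ c₂ c₁ c₃ ne
    ... | refl | refl = four p₁ p₂ p₃ q₁ (ne ∘ ψ-injective) (λ eq → n₁₃ (same (ψ-injective eq) j₁ j₃)) (tf {g} g₁ h₁)
                             (λ eq → n₂₃ (same (ψ-injective eq) j₂ j₃)) (tf {g} g₂ h₁) (tf {g} g₃ h₁)
      where
      same : ∀ {a b e f} → a ≡ b → Joins G e a y → Joins G f b y → e ≡ f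
      same refl = simple

  -- A bipartite graph on three vertices has at most two edges.
  at-most-two : ∀ {g w e₁ e₂ e₃} → Crossing g w e₁ → Crossing g w e₂ → Crossing g w e₃ →
                e₁ ≢ e₂ → e₁ ≢ e₃ → e₂ ≢ e₃ → ⊥
  at-most-two {g} c₁ c₂ c₃ n₁₂ n₁₃ n₂₃ with x c₁ ≟ x c₂ | x c₁ ≟ x c₃
    where open Crossing
  ... | no ne | _     = fan c₁ c₂ c₃ n₁₂ n₁₃ n₂₃ ne
  ... | yes _ | no ne = fan c₁ c₃ c₂ n₁₃ n₁₂ (≢-sym n₂₃) ne
  ... | yes p | yes q =
      four (wx c₁) (wy c₁) (wy c₂) (wy c₃) (tf {g} (gx c₁) (gy c₁)) (tf {g} (gx c₁) (gy c₂)) (tf {g} (gx c₁) (gy c₃))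
                          (parallel c₁ c₂ n₁₂ p) (parallel c₁ c₃ n₁₃ q) (parallel c₂ c₃ n₂₃ (trans (sym p) q))
    where open Crossing

  Bichromatic : (E H → Bool) → V H → Set
  Bichromatic g w = ∃₂ λ e f → Endpoint e w × Endpoint f w × g e ≡ true × g f ≡ false

  module _ (Λ : Linkage G) where
    open Linkage Λ

    private
      fresh : ∀ {a b c d e f z} → Link a b e → Link c d f → z ≡ c ⊎ z ≡ d → z ≢ a → z ≢ b → e ≢ f
      fresh p q z∈ za zb refl with exclusive p q | z∈
      ... | inj₁ (refl , refl) | inj₁ eq = za eq
      ... | inj₁ (refl , refl) | inj₂ eq = zb eq
      ... | inj₂ (refl , refl) | inj₁ eq = zb eq
      ... | inj₂ (refl , refl) | inj₂ eq = za eq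

    -- Three of the paths have to cross a colouring that separates two branch
    -- vertices a and b: one joins a to b, and for each further branch vertex
    -- one joins it to a or to b.
    cut : (g : E H → Bool) → (∀ {w w′} → Bichromatic g w → Bichromatic g w′ → w ≡ w′) →
          ∀ a b → g (ψ (φ a)) ≡ g (ψ (φ b))
    cut g one a b with g (ψ (φ a)) Boolₚ.≟ g (ψ (φ b))
    ... | yes eq = eq
    ... | no ne  = let c , d , ca , cb , da , db , dc = others a b in
                   ⊥-elim (at ca cb da db dc (cross ne) (via c) (via d))
      where
      cross : ∀ {a b} → g (ψ (φ a)) ≢ g (ψ (φ b)) → ∃[ e ] (Link a b e × ∃[ w ] Crossing g w e)
      cross ne = let e , l , x , y , j , gx , gy = crosses (g ∘ ψ) ne
                     w , p , q = share j
                 in e , l , w , crossing j gx gy p q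

      Via : Fin 4 → Set
      Via z = (∃[ e ] (Link a z e × ∃[ w ] Crossing g w e)) ⊎ (∃[ e ] (Link z b e × ∃[ w ] Crossing g w e))

      via : ∀ z → Via z
      via z with g (ψ (φ a)) Boolₚ.≟ g (ψ (φ z))
      ... | yes eq = inj₂ (cross (λ eq′ → ne (trans eq eq′)))
      ... | no ne′ = inj₁ (cross ne′)

      bi : ∀ {e w} → Crossing g w e → Bichromatic g w
      bi (crossing _ gx gy wx wy) = _ , _ , wx , wy , gx , gy

      final : ∀ {e₁ e₂ e₃} → ∃[ w ] Crossing g w e₁ → ∃[ w ] Crossing g w e₂ → ∃[ w ] Crossing g w e₃ →
              e₁ ≢ e₂ → e₁ ≢ e₃ → e₂ ≢ e₃ → ⊥
      final (_ , c₁) (_ , c₂) (_ , c₃) with one (bi c₁) (bi c₂) | one (bi c₁) (bi c₃)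
      ... | refl | refl = at-most-two c₁ c₂ c₃

      at : ∀ {c d} → c ≢ a → c ≢ b → d ≢ a → d ≢ b → d ≢ c →
           (∃[ e ] (Link a b e × ∃[ w ] Crossing g w e)) → Via c → Via d → ⊥
      at ca cb da db dc (_ , l₁ , k₁) (inj₁ (_ , l₂ , k₂)) (inj₁ (_ , l₃ , k₃)) =
        final k₁ k₂ k₃ (fresh l₁ l₂ (inj₂ refl) ca cb) (fresh l₁ l₃ (inj₂ refl) da db) (fresh l₂ l₃ (inj₂ refl) da dc)
      at ca cb da db dc (_ , l₁ , k₁) (inj₁ (_ , l₂ , k₂)) (inj₂ (_ , l₃ , k₃)) =
        final k₁ k₂ k₃ (fresh l₁ l₂ (inj₂ refl) ca cb) (fresh l₁ l₃ (inj₁ refl) da db) (fresh l₂ l₃ (inj₁ refl) da dc)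
      at ca cb da db dc (_ , l₁ , k₁) (inj₂ (_ , l₂ , k₂)) (inj₁ (_ , l₃ , k₃)) =
        final k₁ k₂ k₃ (fresh l₁ l₂ (inj₁ refl) ca cb) (fresh l₁ l₃ (inj₂ refl) da db) (fresh l₂ l₃ (inj₂ refl) dc db)
      at ca cb da db dc (_ , l₁ , k₁) (inj₂ (_ , l₂ , k₂)) (inj₂ (_ , l₃ , k₃)) =
        final k₁ k₂ k₃ (fresh l₁ l₂ (inj₁ refl) ca cb) (fresh l₁ l₃ (inj₁ refl) da db) (fresh l₂ l₃ (inj₁ refl) dc db)

    -- Four branch vertices on a cycle: the m-th gate, between the labels m
    -- and m + 1 (mod 4), can be passed by two of the six paths only, while
    -- the paths between adjacent branch vertices pass one gate or three and
    -- those between opposite ones at least two.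
    module _ (lab : E H → Fin 4) (lab-φ : ∀ a → lab (ψ (φ a)) ≡ a)
             (Gate : Fin 4 → V H → Set) (gate-unique : ∀ {m w w′} → Gate m w → Gate m w′ → w ≡ w′)
             (gated : ∀ {e f w} → Endpoint e w → Endpoint f w → lab e ≢ lab f →
                      ∃[ m ] (Gate m w × Same (lab e , lab f) (m , cyclic m))) where

      private
        -- A passage between the labels m and m + 1 is a crossing for this colouring, which makes
        -- `at-most-two` applicable to the m-th gate.
        is : Fin 4 → E H → Bool
        is m e = does (lab e ≟ m)

        is-true : ∀ {m e} → lab e ≡ m → is m e ≡ true
        is-true {m} {e} eq = dec-true (lab e ≟ m) eq

        is-false : ∀ {m e} → lab e ≡ cyclic m → is m e ≡ false
        is-false {m} {e} eq = dec-false (lab e ≟ m) (λ eq′ → cyclic-≢ m (trans (sym eq) eq′))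

        Passes : Fin 4 → Fin 4 → Fin 4 → Set
        Passes m a b = ∃[ e ] (Link a b e × ∃[ w ] (Gate m w × Crossing (is m) w e))

        -- A path whose ends differ on the arc between the gates `k` and `l` crosses the colouring
        -- by that arc, and labels enter or leave the arc at these two gates only.
        passes : ∀ k l a b → arc k l a ≢ arc k l b → Passes k a b ⊎ Passes l a b
        passes k l a b ne with crosses {a} {b} (arc k l ∘ lab ∘ ψ)
          (λ eq → ne (trans (sym (cong (arc k l) (lab-φ a))) (trans eq (cong (arc k l) (lab-φ b)))))
        ... | e , on , x , y , j , hx , hy with share j
        ... | w , wx , wy with gated wx wy (λ eq → contradiction (trans (sym hx) (trans (cong (arc k l) eq) hy)) λ ())
        ... | m , gm , s = Sum.map (λ { refl → result s }) (λ { refl → result s }) (arc-boundary k l m (differ s))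
          where
          result : Same (lab (ψ x) , lab (ψ y)) (m , cyclic m) → Passes m a b
          result (inj₁ (p , q)) = e , on , w , gm , crossing j (is-true p) (is-false q) wx wy
          result (inj₂ (p , q)) = e , on , w , gm , crossing (joins-sym G {e} j) (is-true q) (is-false p) wy wx
          differ : Same (lab (ψ x) , lab (ψ y)) (m , cyclic m) → arc k l m ≢ arc k l (cyclic m)
          differ (inj₁ (p , q)) eq with () ← trans (sym hx) (trans (cong (arc k l) p) (trans eq (trans (cong (arc k l) (sym q)) hy)))
          differ (inj₂ (p , q)) eq with () ← trans (sym hx) (trans (cong (arc k l) p) (trans (sym eq) (trans (cong (arc k l) (sym q)) hy)))

        -- The gate is a single vertex, and paths of different pairs use different edges there. The
        -- implicit arguments check by evaluation that the pairs differ.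
        full : ∀ {m a b c d e f} {n₁ : False (same? (a , b) (c , d))} {n₂ : False (same? (a , b) (e , f))}
                                 {n₃ : False (same? (c , d) (e , f))} →
               Passes m a b → Passes m c d → Passes m e f → ⊥
        full {n₁ = n₁} {n₂} {n₃} (_ , l₁ , _ , g₁ , c₁) (_ , l₂ , _ , g₂ , c₂) (_ , l₃ , _ , g₃ , c₃)
          with gate-unique g₁ g₂ | gate-unique g₁ g₃
        ... | refl | refl = at-most-two c₁ c₂ c₃ (λ { refl → toWitnessFalse n₁ (exclusive l₁ l₂) })
              (λ { refl → toWitnessFalse n₂ (exclusive l₁ l₃) }) (λ { refl → toWitnessFalse n₃ (exclusive l₂ l₃) })

        one-or-three : {A B C D : Set} → A ⊎ B → A ⊎ C → A ⊎ D → A ⊎ (B × C × D)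
        one-or-three (inj₁ a) _ _ = inj₁ a
        one-or-three _ (inj₁ a) _ = inj₁ a
        one-or-three _ _ (inj₁ a) = inj₁ a
        one-or-three (inj₂ b) (inj₂ c) (inj₂ d) = inj₂ (b , c , d)

        -- If one of `A`, `B` and one of `C`, `D` failed, the hypothesis on these two would fail.
        two-and-two : {A B C D : Set} → A ⊎ C → A ⊎ D → B ⊎ C → B ⊎ D → (A × B) ⊎ (C × D)
        two-and-two (inj₁ a) _ (inj₁ b) _ = inj₁ (a , b)
        two-and-two (inj₁ a) _ (inj₂ c) (inj₁ b) = inj₁ (a , b)
        two-and-two (inj₁ a) _ (inj₂ c) (inj₂ d) = inj₂ (c , d)
        two-and-two (inj₂ c) (inj₂ d) _ _ = inj₂ (c , d)
        two-and-two (inj₂ c) (inj₁ a) (inj₁ b) _ = inj₁ (a , b)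
        two-and-two (inj₂ c) (inj₁ a) (inj₂ _) (inj₁ b) = inj₁ (a , b)
        two-and-two (inj₂ c) (inj₁ a) (inj₂ _) (inj₂ d) = inj₂ (c , d)

        One : Fin 4 → Fin 4 → Fin 4 → Fin 4 → Fin 4 → Fin 4 → Set
        One m a b k l n = Passes m a b ⊎ (Passes k a b × Passes l a b × Passes n a b)

        Two : Fin 4 → Fin 4 → Fin 4 → Fin 4 → Fin 4 → Fin 4 → Set
        Two a b k l m n = (Passes k a b × Passes l a b) ⊎ (Passes m a b × Passes n a b)

        -- The total count is tight: the gates admit eight passes and the paths need at least eight.
        -- But whichever half of the cycle each of the two paths between opposite branch vertices
        -- takes, the halves share a gate, which is then full. The path between the branch vertices
        -- on its two sides must go the long way round. This fills another gate, whose own short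
        -- path is also forced the long way, through the gate that was full already.
        overloaded : Two 0F 2F 0F 1F 2F 3F → Two 1F 3F 1F 2F 0F 3F →
                     One 0F 0F 1F 1F 2F 3F → One 1F 1F 2F 0F 2F 3F →
                     One 2F 2F 3F 0F 1F 3F → One 3F 0F 3F 0F 1F 2F → ⊥
        overloaded (inj₁ (a₀ , a₁)) (inj₁ (b₁ , b₂)) _ (inj₁ c) _ _                       = full a₁ b₁ c
        overloaded (inj₁ (a₀ , a₁)) (inj₁ (b₁ , b₂)) (inj₁ d) (inj₂ (c₀ , _)) _ _         = full a₀ c₀ d
        overloaded (inj₁ (a₀ , a₁)) (inj₁ (b₁ , b₂)) (inj₂ (d₁ , _)) (inj₂ _) _ _         = full a₁ b₁ d₁
        overloaded (inj₁ (a₀ , a₁)) (inj₂ (b₀ , b₃)) (inj₁ c) _ _ _                       = full a₀ b₀ c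
        overloaded (inj₁ (a₀ , a₁)) (inj₂ (b₀ , b₃)) (inj₂ (c₁ , _)) (inj₁ d) _ _         = full a₁ c₁ d
        overloaded (inj₁ (a₀ , a₁)) (inj₂ (b₀ , b₃)) (inj₂ _) (inj₂ (d₀ , _)) _ _         = full a₀ b₀ d₀
        overloaded (inj₂ (a₂ , a₃)) (inj₁ (b₁ , b₂)) _ _ (inj₁ c) _                       = full a₂ b₂ c
        overloaded (inj₂ (a₂ , a₃)) (inj₁ (b₁ , b₂)) _ (inj₁ d) (inj₂ (_ , c₁ , _)) _     = full b₁ c₁ d
        overloaded (inj₂ (a₂ , a₃)) (inj₁ (b₁ , b₂)) _ (inj₂ (_ , d₂ , _)) (inj₂ _) _     = full a₂ b₂ d₂
        overloaded (inj₂ (a₂ , a₃)) (inj₂ (b₀ , b₃)) _ _ _ (inj₁ c)                       = full a₃ b₃ c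
        overloaded (inj₂ (a₂ , a₃)) (inj₂ (b₀ , b₃)) _ _ (inj₁ d) (inj₂ (_ , _ , c₂))     = full a₂ c₂ d
        overloaded (inj₂ (a₂ , a₃)) (inj₂ (b₀ , b₃)) _ _ (inj₂ (_ , _ , d₃)) (inj₂ _)     = full a₃ b₃ d₃

      not-cyclic : ⊥
      not-cyclic = overloaded
        (two-and-two (passes 0F 2F 0F 2F λ ()) (passes 0F 3F 0F 2F λ ()) (passes 1F 2F 0F 2F λ ()) (passes 1F 3F 0F 2F λ ()))
        (two-and-two (Sum.swap (passes 0F 1F 1F 3F λ ())) (passes 1F 3F 1F 3F λ ())
                     (Sum.swap (passes 0F 2F 1F 3F λ ())) (passes 2F 3F 1F 3F λ ()))
        (one-or-three (passes 0F 1F 0F 1F λ ()) (passes 0F 2F 0F 1F λ ()) (passes 0F 3F 0F 1F λ ()))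
        (one-or-three (Sum.swap (passes 0F 1F 1F 2F λ ())) (passes 1F 2F 1F 2F λ ()) (passes 1F 3F 1F 2F λ ()))
        (one-or-three (Sum.swap (passes 0F 2F 2F 3F λ ())) (Sum.swap (passes 1F 2F 2F 3F λ ())) (passes 2F 3F 2F 3F λ ()))
        (one-or-three (Sum.swap (passes 0F 3F 0F 3F λ ())) (Sum.swap (passes 1F 3F 0F 3F λ ())) (Sum.swap (passes 2F 3F 0F 3F λ ())))

-- Components, positions and levels

module _ {A : Set} where

  unique-++ˡ : (xs : List A) {ys : List A} → Unique (xs ++ ys) → Unique xs
  unique-++ˡ []       _        = []
  unique-++ˡ (x ∷ xs) (x∉ ∷ u) = Allₚ.++⁻ˡ xs x∉ ∷ unique-++ˡ xs u

  unique-++ʳ : (xs : List A) {ys : List A} → Unique (xs ++ ys) → Unique ys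
  unique-++ʳ []       u       = u
  unique-++ʳ (_ ∷ xs) (_ ∷ u) = unique-++ʳ xs u

module _ {H : Graph} where

  unique-rev : ∀ {x y} (p : Walk H x y) → Unique (edges p) → Unique (edges (rev p))
  unique-rev nil          _        = []
  unique-rev (cons e j p) (e∉ ∷ u) = subst Unique (sym (edges-⟫ (rev p) (cons e (joins-sym H {e} j) nil)))
    (++⁺ (unique-rev p u) ([] ∷ []) (λ { (m , here refl) → All.lookup e∉ (∈-rev⁻ p m) refl }))

module Components (H : Graph) where
  open Graph H using (ends; Endpoint)
  open DecMembership (_≟_ {Graph.#E H}) using (_∈?_)

  private
    merge : ∀ {x y : V H} → V H → V H → Dec (x ≡ y) → V H
    merge a b (yes _) = a
    merge a b (no _)  = b

    -- Union-find: an added edge redirects the class of its second end to that of its first. With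
    -- representatives, lying in one component is a decidable equation.
    component : List (E H) → V H → V H
    component []       x = x
    component (e ∷ es) x = merge (r (proj₁ (ends e))) (r x) (r x ≟ r (proj₂ (ends e)))
      where r = component es

    Linked : List (E H) → V H → V H → Set
    Linked es x y = Σ (Walk H x y) λ p → ∀ {e} → e ∈ edges p → e ∈ es

    linked-trans : ∀ {es x y z} → Linked es x y → Linked es y z → Linked es x z
    linked-trans (p , p⊆) (q , q⊆) = p ⟫ q , λ m → [ p⊆ , q⊆ ] (∈-⟫⁻ p q m)

    linked-sym : ∀ {es x y} → Linked es x y → Linked es y x
    linked-sym (p , p⊆) = rev p , λ m → p⊆ (∈-rev⁻ p m)

    linked-there : ∀ {e es x y} → Linked es x y → Linked (e ∷ es) x y
    linked-there (p , p⊆) = p , there ∘ p⊆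

    to-component : ∀ es x → Linked es x (component es x)
    to-component []       x = nil , λ ()
    to-component (e ∷ es) x with component es x ≟ component es (proj₂ (ends e))
    ... | no _   = linked-there (to-component es x)
    ... | yes eq = linked-trans (linked-there (to-component es x)) (linked-trans
                     (linked-there (linked-sym (subst (Linked es _) (sym eq) (to-component es (proj₂ (ends e))))))
                     (linked-trans (cons e (joins-sym H {e} (joins-ends H e)) nil , λ { (here refl) → here refl })
                                   (linked-there (to-component es (proj₁ (ends e))))))

    component-edge : ∀ {e es} → e ∈ es → component es (proj₁ (ends e)) ≡ component es (proj₂ (ends e))
    component-edge {e} {_ ∷ es} (here refl)
      with component es (proj₁ (ends e)) ≟ component es (proj₂ (ends e))
         | component es (proj₂ (ends e)) ≟ component es (proj₂ (ends e))
    ... | yes _ | yes _ = refl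
    ... | no _  | yes _ = refl
    ... | _     | no ne = contradiction refl ne
    component-edge {e} {f ∷ es} (there m) =
      cong (λ x → merge (component es (proj₁ (ends f))) x (x ≟ component es (proj₂ (ends f)))) (component-edge m)

    rest : List (E H) → List (E H)
    rest C = filter (λ e → ¬? (e ∈? C)) (allFin _)

  abstract
    -- Represents the component of a vertex in `H` minus the edges of `C`.
    componentOff : List (E H) → V H → V H
    componentOff C = component (rest C)

    componentOff-walk : ∀ C {x y} → componentOff C x ≡ componentOff C y → Σ (Walk H x y) λ p → Disjoint (edges p) C
    componentOff-walk C {x} {y} eq =
      let p , p⊆ = linked-trans (to-component (rest C) x)
                                (subst (λ z → Linked (rest C) z y) (sym eq) (linked-sym (to-component (rest C) y)))
      in p , λ (m , m′) → proj₂ (∈-filter⁻ (λ e → ¬? (e ∈? C)) {xs = allFin _} (p⊆ m)) m′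

    componentOff-edge : ∀ C {e x y} → e ∉ C → Endpoint e x → Endpoint e y → componentOff C x ≡ componentOff C y
    componentOff-edge C {e} e∉ p q = trans (sym (side p)) (side q)
      where
      side : ∀ {z} → Endpoint e z → componentOff C (proj₁ (ends e)) ≡ componentOff C z
      side (inj₁ refl) = refl
      side (inj₂ refl) = component-edge (∈-filter⁺ (λ e → ¬? (e ∈? C)) (∈-allFin e) e∉)

module Positions {H : Graph} where
  open Graph H using (Endpoint)

  posV : ∀ {x y} → Walk H x y → V H → ℕ
  posV nil              _ = 0
  posV {x} (cons _ _ p) w with w ≟ x
  ... | yes _ = 0
  ... | no _  = suc (posV p w)

  posE : ∀ {x y} → Walk H x y → E H → ℕ
  posE nil          _ = 0
  posE (cons e _ p) f with f ≟ e
  ... | yes _ = 1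
  ... | no _  = suc (posE p f)

  posV-start : ∀ {x y} (p : Walk H x y) → posV p x ≡ 0
  posV-start nil = refl
  posV-start {x} (cons _ _ p) with x ≟ x
  ... | yes _ = refl
  ... | no ne = contradiction refl ne

  posV-tail : ∀ {x y z w e} (j : Joins H e x y) (p : Walk H y z) → Unique (vertices (cons e j p)) →
              w ∈ vertices p → posV (cons e j p) w ≡ suc (posV p w)
  posV-tail {x} {w = w} j p (x∉ ∷ _) m with w ≟ x
  ... | yes refl = contradiction refl (All.lookup x∉ m)
  ... | no _     = refl

  posV-injective : ∀ {x y} (p : Walk H x y) {v w} → v ∈ vertices p → w ∈ vertices p → posV p v ≡ posV p w → v ≡ w
  posV-injective nil (here refl) (here refl) _ = refl
  posV-injective {x} (cons e j p) {v} {w} m n eq with v ≟ x | w ≟ x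
  ... | yes refl | yes refl = refl
  ... | no v≢x   | no w≢x   = posV-injective p (Any.tail v≢x m) (Any.tail w≢x n) (ℕₚ.suc-injective eq)

  posE-positive : ∀ {x y} (p : Walk H x y) {e} → e ∈ edges p → 0 ℕ.< posE p e
  posE-positive (cons e j p) {f} _ with f ≟ e
  ... | yes _ = s≤s z≤n
  ... | no _  = s≤s z≤n

  posE-injective : ∀ {x y} (p : Walk H x y) {e f} → e ∈ edges p → f ∈ edges p → posE p e ≡ posE p f → e ≡ f
  posE-injective (cons e₀ j p) {e} {f} m n eq with e ≟ e₀ | f ≟ e₀
  ... | yes refl | yes refl = refl
  ... | yes refl | no f≢    = contradiction (sym (ℕₚ.suc-injective eq)) (ℕₚ.>⇒≢ (posE-positive p (Any.tail f≢ n)))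
  ... | no e≢    | yes refl = contradiction (ℕₚ.suc-injective eq) (ℕₚ.>⇒≢ (posE-positive p (Any.tail e≢ m)))
  ... | no e≢    | no f≢    = posE-injective p (Any.tail e≢ m) (Any.tail f≢ n) (ℕₚ.suc-injective eq)

  -- The k-th edge joins the vertices with positions k - 1 and k.
  pos-endpoint : ∀ {x y} (p : Walk H x y) → Unique (vertices p) → ∀ {f w} → f ∈ edges p → Endpoint f w →
                 posE p f ≡ posV p w ⊎ posE p f ≡ suc (posV p w)
  pos-endpoint {x} (cons {y = z} e j p) u {f} {w} m end with f ≟ e
  pos-endpoint {x} (cons {y = z} e j p) u {f} {w} m end | yes refl with endpoint-cases H {e} j end
  ... | inj₁ refl = inj₂ (cong suc (sym (posV-start (cons e j p))))
  ... | inj₂ refl = inj₁ (sym (trans (posV-tail j p u (start-∈ p)) (cong suc (posV-start p))))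
  pos-endpoint {x} (cons {y = z} e j p) u {f} {w} (here eq) end | no f≢ = contradiction eq f≢
  pos-endpoint {x} (cons {y = z} e j p) u@(_ ∷ u′) {f} {w} (there m) end | no f≢ =
    Sum.map (λ eq → trans (cong suc eq) (sym tl)) (λ eq → trans (cong suc eq) (cong suc (sym tl))) (pos-endpoint p u′ m end)
    where
    tl : posV (cons e j p) w ≡ suc (posV p w)
    tl = posV-tail j p u (endpoint-∈ p m end)

  posE-bound : ∀ {x y} (p : Walk H x y) → Unique (vertices p) → ∀ {f} → f ∈ edges p → posE p f ℕ.≤ posV p y
  posE-bound {y = y} (cons e j p) u@(_ ∷ u′) {f} m rewrite posV-tail j p u (end-∈ p) with f ≟ e
  ... | yes _ = s≤s z≤n
  posE-bound (cons e j p) _        (here eq) | no ne = contradiction eq ne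
  posE-bound (cons e j p) (_ ∷ u′) (there m) | no ne = s≤s (posE-bound p u′ m)

holds : {A : Set} (d : Dec A) → does d ≡ true → A
holds (yes a) _ = a

fails : {A : Set} (d : Dec A) → does d ≡ false → ¬ A
fails (no ¬a) _ = ¬a

module Levels {p q r : ℕ} (p<q : p ℕ.< q) (q<r : q ℕ.< r) where

  abstract
    level : ℕ → Fin 4
    level n with n ℕ.<? p | n ℕ.<? q | n ℕ.<? r
    ... | yes _ | _     | _     = 0F
    ... | no _  | yes _ | _     = 1F
    ... | no _  | no _  | yes _ = 2F
    ... | no _  | no _  | no _  = 3F

    level-0 : ∀ {n} → n ℕ.< p → level n ≡ 0F
    level-0 {n} n<p with n ℕ.<? p
    ... | yes _  = refl
    ... | no n≮p = contradiction n<p n≮p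

    level-1 : ∀ {n} → p ℕ.≤ n → n ℕ.< q → level n ≡ 1F
    level-1 {n} p≤n n<q with n ℕ.<? p | n ℕ.<? q
    ... | yes n<p | _      = contradiction n<p (ℕₚ.≤⇒≯ p≤n)
    ... | no _    | yes _  = refl
    ... | no _    | no n≮q = contradiction n<q n≮q

    level-2 : ∀ {n} → q ℕ.≤ n → n ℕ.< r → level n ≡ 2F
    level-2 {n} q≤n n<r with n ℕ.<? p | n ℕ.<? q | n ℕ.<? r
    ... | yes n<p | _       | _      = contradiction (ℕₚ.<-trans n<p p<q) (ℕₚ.≤⇒≯ q≤n)
    ... | no _    | yes n<q | _      = contradiction n<q (ℕₚ.≤⇒≯ q≤n)
    ... | no _    | no _    | yes _  = refl
    ... | no _    | no _    | no n≮r = contradiction n<r n≮r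

    level-3 : ∀ {n} → r ℕ.≤ n → level n ≡ 3F
    level-3 {n} r≤n with n ℕ.<? p | n ℕ.<? q | n ℕ.<? r
    ... | yes n<p | _       | _       = contradiction (ℕₚ.<-trans n<p (ℕₚ.<-trans p<q q<r)) (ℕₚ.≤⇒≯ r≤n)
    ... | no _    | yes n<q | _       = contradiction (ℕₚ.<-trans n<q q<r) (ℕₚ.≤⇒≯ r≤n)
    ... | no _    | no _    | yes n<r = contradiction n<r (ℕₚ.≤⇒≯ r≤n)
    ... | no _    | no _    | no _    = refl

  -- There is none for `3F`: the levels 3 and 0 meet where the cycle closes, not at a step of the
  -- position.
  data Threshold : Fin 4 → ℕ → Set where
    at-p : Threshold 0F p
    at-q : Threshold 1F q
    at-r : Threshold 2F r

  level-step : ∀ n → level n ≡ level (suc n) ⊎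
               (∃[ m ] (Threshold m (suc n) × level n ≡ m × level (suc n) ≡ cyclic m))
  level-step n with n ℕ.<? p
  level-step n | yes n<p with ℕₚ.m≤n⇒m<n∨m≡n n<p
  ... | inj₁ sn<p = inj₁ (trans (level-0 n<p) (sym (level-0 sn<p)))
  ... | inj₂ refl = inj₂ (0F , at-p , level-0 n<p , level-1 ℕₚ.≤-refl p<q)
  level-step n | no n≮p with n ℕ.<? q
  level-step n | no n≮p | yes n<q with ℕₚ.m≤n⇒m<n∨m≡n n<q | ℕₚ.≮⇒≥ n≮p
  ... | inj₁ sn<q | p≤n = inj₁ (trans (level-1 p≤n n<q) (sym (level-1 (ℕₚ.m≤n⇒m≤1+n p≤n) sn<q)))
  ... | inj₂ refl | p≤n = inj₂ (1F , at-q , level-1 p≤n n<q , level-2 ℕₚ.≤-refl q<r)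
  level-step n | no n≮p | no n≮q with n ℕ.<? r
  level-step n | no n≮p | no n≮q | yes n<r with ℕₚ.m≤n⇒m<n∨m≡n n<r | ℕₚ.≮⇒≥ n≮q
  ... | inj₁ sn<r | q≤n = inj₁ (trans (level-2 q≤n n<r) (sym (level-2 (ℕₚ.m≤n⇒m≤1+n q≤n) sn<r)))
  ... | inj₂ refl | q≤n = inj₂ (2F , at-r , level-2 q≤n n<r , level-3 ℕₚ.≤-refl)
  level-step n | no n≮p | no n≮q | no n≮r =
    inj₁ (trans (level-3 (ℕₚ.≮⇒≥ n≮r)) (sym (level-3 (ℕₚ.m≤n⇒m≤1+n (ℕₚ.≮⇒≥ n≮r)))))

-- K₄-models from K₄-immersions

module FindModel {G H : Graph} (rep : LineRep G H) (subcubic : ∀ c → ¬ FourAt H c) (Λ : Linkage G) where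
  open LineRep rep using (ψ; ψ-injective)
  open Graph H using (ends; Endpoint)
  open Subcubic rep subcubic
  open Linkage Λ
  open Components H
  open Positions {H}
  open DecMembership (_≟_ {Graph.#E H}) using (_∈?_)
  open DecMembership (_≟_ {Graph.#V H}) using () renaming (_∈?_ to _∈ᵥ?_)

  private
    e₁ : E H
    e₁ = ψ (φ 0F)

    u v : V H
    u = proj₁ (ends e₁)
    v = proj₂ (ends e₁)

    anEnd : E H → V H
    anEnd f = proj₁ (ends f)

    anEnd-endpoint : ∀ f → Endpoint f (anEnd f)
    anEnd-endpoint f = inj₁ refl

    -- Were `e₁` a bridge, the edges on its `u`-side could be coloured together with `e₁`,
    -- bichromatic only at `v`, or without it, bichromatic only at `u`. The first cut puts
    -- `ψ (φ 1F)` on the `u`-side, and the second then separates it from `e₁`.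
    bridgeless : componentOff (e₁ ∷ []) u ≡ componentOff (e₁ ∷ []) v
    bridgeless with componentOff (e₁ ∷ []) u ≟ componentOff (e₁ ∷ []) v
    ... | yes eq = eq
    ... | no u≁v = contradiction (trans (sym g₂e₂) (trans (cut Λ g₂ one₂ 1F 0F) g₂e₁)) λ ()
      where
      c : V H → V H
      c = componentOff (e₁ ∷ [])

      off : ∀ {f w} → f ≢ e₁ → Endpoint f w → c (anEnd f) ≡ c w
      off {f} f≢ = componentOff-edge (e₁ ∷ []) (λ { (here eq) → f≢ eq }) (anEnd-endpoint f)

      d₁ : ∀ f → Dec (f ≡ e₁ ⊎ c (anEnd f) ≡ c u)
      d₁ f = (f ≟ e₁) ⊎-dec (c (anEnd f) ≟ c u)

      d₂ : ∀ f → Dec (f ≢ e₁ × c (anEnd f) ≡ c u)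
      d₂ f = ¬? (f ≟ e₁) ×-dec (c (anEnd f) ≟ c u)

      g₁ g₂ : E H → Bool
      g₁ f = does (d₁ f)
      g₂ f = does (d₂ f)

      only₁ : ∀ {w} → Bichromatic g₁ w → w ≡ v
      only₁ {w} (e , f , we , wf , ge , gf) with holds (d₁ e) ge | fails (d₁ f) gf
      ... | inj₁ refl | ¬f = [ (λ { refl → contradiction (inj₂ (off (¬f ∘ inj₁) wf)) ¬f }) , id ]
                               (endpoint-cases H {e₁} (joins-ends H e₁) we)
      ... | inj₂ ce   | ¬f with e ≟ e₁
      ...   | yes refl = [ (λ { refl → contradiction (inj₂ (off (¬f ∘ inj₁) wf)) ¬f }) , id ]
                           (endpoint-cases H {e₁} (joins-ends H e₁) we)
      ...   | no e≢    = contradiction (inj₂ (trans (off (¬f ∘ inj₁) wf) (trans (sym (off e≢ we)) ce))) ¬f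

      only₂ : ∀ {w} → Bichromatic g₂ w → w ≡ u
      only₂ {w} (e , f , we , wf , ge , gf) with holds (d₂ e) ge | fails (d₂ f) gf | f ≟ e₁
      ... | e≢ , ce | ¬f | no f≢ = contradiction (f≢ , trans (off f≢ wf) (trans (sym (off e≢ we)) ce)) ¬f
      ... | e≢ , ce | ¬f | yes refl with endpoint-cases H {e₁} (joins-ends H e₁) wf
      ...   | inj₁ w≡u  = w≡u
      ...   | inj₂ refl = contradiction (trans (sym ce) (off e≢ we)) u≁v

      one₁ : ∀ {w w′} → Bichromatic g₁ w → Bichromatic g₁ w′ → w ≡ w′
      one₁ p q = trans (only₁ p) (sym (only₁ q))

      one₂ : ∀ {w w′} → Bichromatic g₂ w → Bichromatic g₂ w′ → w ≡ w′
      one₂ p q = trans (only₂ p) (sym (only₂ q))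

      e₂≢e₁ : ψ (φ 1F) ≢ e₁
      e₂≢e₁ eq = contradiction (injective (ψ-injective eq)) λ ()

      g₂e₁ : g₂ e₁ ≡ false
      g₂e₁ = dec-false (d₂ e₁) (λ (ne , _) → ne refl)

      g₂e₂ : g₂ (ψ (φ 1F)) ≡ true
      g₂e₂ with holds (d₁ (ψ (φ 1F))) (trans (cut Λ g₁ one₁ 1F 0F) (dec-true (d₁ e₁) (inj₁ refl)))
      ... | inj₁ eq = contradiction eq e₂≢e₁
      ... | inj₂ ce = dec-true (d₂ (ψ (φ 1F))) (e₂≢e₁ , ce)

    -- Three parallel edges exhaust the degree of `s` and `t`, so colouring by membership in `T` is
    -- bichromatic nowhere. By `cut` all four branch vertices would be among three edges.
    not-triple : ∀ {s t f g} → Joins H e₁ s t → Joins H f s t → Joins H g s t → e₁ ≢ f → e₁ ≢ g → f ≢ g → ⊥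
    not-triple {s} {t} {f} {g} je jf jg ef eg fg =
      let a , b , a<b , eq = pigeonhole {3} {4} ℕₚ.≤-refl (λ a → index (inside a))
      in <⇒≢ a<b (injective (ψ-injective (trans (lookup-index (inside a))
           (trans (cong (lookup T) eq) (sym (lookup-index (inside b)))))))
      where
      T : List (E H)
      T = e₁ ∷ f ∷ g ∷ []

      triple : ∀ {e} → e ∈ T → Joins H e s t
      triple (here refl)                 = je
      triple (there (here refl))         = jf
      triple (there (there (here refl))) = jg

      incident : ∀ {w} → w ≡ s ⊎ w ≡ t → ∀ {e} → e ∈ T → Endpoint e w
      incident (inj₁ refl) {e} m = joins⇒endpointˡ H {e} (triple m)
      incident (inj₂ refl) {e} m = joins⇒endpointʳ H {e} (triple m)

      mono : ∀ {w} → ¬ Bichromatic (λ e → does (e ∈? T)) w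
      mono {w} (a , b , wa , wb , ga , gb) =
        subcubic w (b , e₁ , f , g , All.tabulate (λ { m refl → b∉ m }) ∷ (ef ∷ eg ∷ []) ∷ (fg ∷ []) ∷ [] ∷ [] ,
                    wb ∷ All.tabulate at)
        where
        b∉ : b ∉ T
        b∉ = fails (b ∈? T) gb
        at : ∀ {e} → e ∈ T → Endpoint e w
        at = incident (endpoint-cases H {a} (triple (holds (a ∈? T) ga)) wa)

      inside : ∀ a → ψ (φ a) ∈ T
      inside a = holds (ψ (φ a) ∈? T) (trans (cut Λ (λ e → does (e ∈? T)) (λ p _ → contradiction p mono) a 0F)
                                             (dec-true (e₁ ∈? T) (here refl)))

  module OnCycle (path : Path H u v) (e₁∉ : e₁ ∉ edges (Path.walk path)) where
    private
      P : Walk H u v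
      P = Path.walk path

      C : List (E H)
      C = e₁ ∷ edges P

      c : V H → V H
      c = componentOff C

      P-unique : Unique (edges P)
      P-unique = simple⇒unique-edges P (Path.simple path)

    module _ {s t} (s≢t : s ≢ t) (A : Walk H u s) (M : Walk H s t) (Z : Walk H t v)
             (P≡ : edges P ≡ edges A ++ edges M ++ edges Z) (Q : Walk H s t) (Q∩C : Disjoint (edges Q) C) where
      private
        U : Unique (edges A ++ edges M ++ edges Z)
        U = subst Unique P≡ P-unique

        inP : ∀ {e} → e ∈ edges A ++ edges M ++ edges Z → e ∈ edges P
        inP = subst (_ ∈_) (sym P≡)

        fromM : ∀ {e} → e ∈ edges M → e ∈ edges M ++ edges Z
        fromM = ∈-++⁺ˡ

        fromZ : ∀ {e} → e ∈ edges Z → e ∈ edges M ++ edges Z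
        fromZ = ∈-++⁺ʳ (edges M)

        -- The other arc of the cycle between `s` and `t`, the one through `e₁`.
        R : Walk H s t
        R = rev A ⟫ cons e₁ (joins-ends H e₁) (rev Z)

        R⁻ : ∀ {e} → e ∈ edges R → e ∈ edges A ⊎ e ≡ e₁ ⊎ e ∈ edges Z
        R⁻ m with ∈-⟫⁻ (rev A) _ m
        ... | inj₁ n           = inj₁ (∈-rev⁻ A n)
        ... | inj₂ (here eq)   = inj₂ (inj₁ eq)
        ... | inj₂ (there n)   = inj₂ (inj₂ (∈-rev⁻ Z n))

        e₁∈R : e₁ ∈ edges R
        e₁∈R =
            subst (e₁ ∈_) (sym (edges-⟫ (rev A) (cons e₁ (joins-ends H e₁) (rev Z)))) (∈-++⁺ʳ (edges (rev A)) (here refl))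

        R-unique : Unique (edges R)
        R-unique = subst Unique (sym (edges-⟫ (rev A) (cons e₁ (joins-ends H e₁) (rev Z))))
          (++⁺ (unique-rev A (unique-++ˡ (edges A) U))
               (All.tabulate (λ { m refl → e₁∉ (inP (∈-++⁺ʳ (edges A) (fromZ (∈-rev⁻ Z m)))) })
                 ∷ unique-rev Z (unique-++ʳ (edges M) (unique-++ʳ (edges A) U)))
               (λ { (m , here refl) → e₁∉ (inP (∈-++⁺ˡ (∈-rev⁻ A m)))
                  ; (m , there n)   → unique-++⇒disjoint (edges A) U (∈-rev⁻ A m , fromZ (∈-rev⁻ Z n)) }))

        R⊆C : ∀ {e} → e ∈ edges R → e ∈ C
        R⊆C m with R⁻ m
        ... | inj₁ n        = there (inP (∈-++⁺ˡ n))
        ... | inj₂ (inj₁ n) = here n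
        ... | inj₂ (inj₂ n) = there (inP (∈-++⁺ʳ (edges A) (fromZ n)))

        open Shortening (shorten Q) renaming (path to S)
        N : Walk H s t
        N = Path.walk S

        R∩M : Disjoint (edges R) (edges M)
        R∩M (m , n) with R⁻ m
        ... | inj₁ a           = unique-++⇒disjoint (edges A) U (a , fromM n)
        ... | inj₂ (inj₁ refl) = e₁∉ (inP (∈-++⁺ʳ (edges A) (fromM n)))
        ... | inj₂ (inj₂ z)    = unique-++⇒disjoint (edges M) (unique-++ʳ (edges A) U) (n , z)

        R∩N : Disjoint (edges R) (edges N)
        R∩N (m , n) = Q∩C (fewer n , R⊆C m)

        M∩N : Disjoint (edges M) (edges N)
        M∩N (m , n) = Q∩C (fewer n , there (inP (∈-++⁺ʳ (edges A) (fromM m))))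

        flip : ∀ {xs ys : List (E H)} → Disjoint xs ys → Disjoint ys xs
        flip d (m , n) = d (n , m)

        single : ∀ {xs : List (E H)} {e f} → xs ≡ e ∷ [] → f ∈ xs → f ≡ e
        single refl (here eq) = eq

        first : ∀ {xs : List (E H)} {e} → xs ≡ e ∷ [] → e ∈ xs
        first refl = here refl

      -- Any of the three walks that is longer than one edge can be the one to split in
      -- `theta⇒model`. If there is none, they are three parallel edges, one of them `e₁`.
      ear⇒model : Model 4 G
      ear⇒model with theta⇒model rep s≢t R M N R-unique R∩M R∩N M∩N
                   | theta⇒model rep s≢t M R N (unique-++ˡ (edges M) (unique-++ʳ (edges A) U)) (flip R∩M) M∩N R∩N
                   | theta⇒model rep s≢t N R M (simple⇒unique-edges N (Path.simple S)) (flip R∩N) (flip M∩N) R∩M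
      ... | inj₁ model | _ | _ = model
      ... | _ | inj₁ model | _ = model
      ... | _ | _ | inj₁ model = model
      ... | inj₂ (e , eqR , je) | inj₂ (f , eqM , jf) | inj₂ (g , eqN , jg) =
        ⊥-elim (not-triple {f = f} {g} (subst (λ e → Joins H e s t) (sym (single eqR e₁∈R)) je) jf jg
                  (λ eq → R∩M (e₁∈R , subst (_∈ edges M) (sym eq) (first eqM)))
                  (λ eq → R∩N (e₁∈R , subst (_∈ edges N) (sym eq) (first eqN)))
                  (λ eq → M∩N (first eqM , subst (_∈ edges N) (sym eq) (first eqN))))

    chord⇒model : ∀ {s t} → s ∈ vertices P → t ∈ vertices P → s ≢ t → c s ≡ c t → Model 4 G
    chord⇒model {s} {t} s∈ t∈ s≢t eq with componentOff-walk C eq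
    ... | Q , Q∩C with splitAt P s∈
    ... | split B D P≡ _ vs with vs t∈
    ... | inj₂ t∈D = let split M Z D≡ _ _ = splitAt D t∈D in
      ear⇒model s≢t B M Z (trans P≡ (cong (edges B ++_) D≡)) Q Q∩C
    -- Here `t` precedes `s` on `P`: their roles are exchanged and the ear is reversed.
    ... | inj₁ t∈B = let split A M B≡ _ _ = splitAt B t∈B in
      ear⇒model (≢-sym s≢t) A M D
        (trans P≡ (trans (cong (_++ edges D) B≡) (++-assoc (edges A) (edges M) (edges D))))
        (rev Q) (λ (m , n) → Q∩C (∈-rev⁻ Q m , n))

    module Chordless (chordless : ∀ {s t} → s ∈ vertices P → t ∈ vertices P → c s ≡ c t → s ≡ t) where

      private
        off : ∀ {f w} → f ∉ C → Endpoint f w → c (anEnd f) ≡ c w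
        off {f} f∉ = componentOff-edge C f∉ (anEnd-endpoint f)

        C-on : ∀ {f w} → f ∈ C → Endpoint f w → w ∈ vertices P
        C-on (here refl) end with endpoint-cases H {e₁} (joins-ends H e₁) end
        ... | inj₁ refl = start-∈ P
        ... | inj₂ refl = end-∈ P
        C-on (there m) end = endpoint-∈ P m end

      -- Colour the edges off the cycle in the component of an offending branch vertex. They meet
      -- other edges only on `P`, and by `chordless` at one vertex only; but `e₁` has the other
      -- colour.
      all-on-cycle : ∀ a → ψ (φ a) ∈ C
      all-on-cycle a with ψ (φ a) ∈? C
      ... | yes m  = m
      ... | no f∉C = contradiction (trans (sym (dec-true (d (ψ (φ a))) (f∉C , refl)))
                                          (trans (cut Λ (does ∘ d) one a 0F) (dec-false (d e₁) (λ (∉ , _) → ∉ (here refl))))) λ ()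
        where
        d : ∀ f → Dec (f ∉ C × c (anEnd f) ≡ c (anEnd (ψ (φ a))))
        d f = ¬? (f ∈? C) ×-dec (c (anEnd f) ≟ c (anEnd (ψ (φ a))))
        where-on : ∀ {w} → Bichromatic (does ∘ d) w → w ∈ vertices P × c w ≡ c (anEnd (ψ (φ a)))
        where-on {w} (e , f , we , wf , ge , gf) with holds (d e) ge | f ∈? C
        ... | e∉ , ce | yes f∈ = C-on f∈ wf , trans (sym (off e∉ we)) ce
        ... | e∉ , ce | no f∉  = contradiction (f∉ , trans (off f∉ wf) (trans (sym (off e∉ we)) ce)) (fails (d f) gf)
        one : ∀ {w w′} → Bichromatic (does ∘ d) w → Bichromatic (does ∘ d) w′ → w ≡ w′
        one p q = let m , x = where-on p ; n , y = where-on q in chordless m n (trans x (sym y))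

      -- Positions on the cycle: the k-th edge and the k-th vertex of P have
      -- position k (vertices being counted from 0 and edges from 1), e₁ has
      -- position 0, and everything hanging off a vertex inherits its position.
      private
        Anchored : V H → Set
        Anchored w = ∃[ s ] (s ∈ vertices P × c s ≡ c w)

        anchored? : ∀ w → Dec (Anchored w)
        anchored? w = any? (λ s → (s ∈ᵥ? vertices P) ×-dec (c s ≟ c w))

        -- The value 0 is for components that miss the cycle; being constant, it creates no change
        -- of label inside them.
        anchor : ∀ {w} → Dec (Anchored w) → ℕ
        anchor (yes (s , _)) = posV P s
        anchor (no _)        = 0

        anchor-unique : ∀ {w w′} → c w ≡ c w′ → (d : Dec (Anchored w)) (d′ : Dec (Anchored w′)) → anchor d ≡ anchor d′
        anchor-unique eq (yes (s , m , x)) (yes (t , n , y)) =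
            cong (posV P) (chordless m n (trans x (trans eq (sym y))))
        anchor-unique eq (yes (s , m , x)) (no ¬a)           = contradiction (s , m , trans x eq) ¬a
        anchor-unique eq (no ¬a)           (yes (t , n , y)) = contradiction (t , n , trans y (sym eq)) ¬a
        anchor-unique eq (no _)            (no _)            = refl

        pv : V H → ℕ
        pv w = anchor (anchored? w)

        pv-on : ∀ {w} → w ∈ vertices P → pv w ≡ posV P w
        pv-on {w} m = anchor-unique refl (anchored? w) (yes (w , m , refl))

        place : ∀ f → Dec (f ∈ edges P) → ℕ
        place f (yes _) = posE P f
        place f (no _)  = pv (anEnd f)

        pe : E H → ℕ
        pe f = place f (f ∈? edges P)

        pe-on : ∀ {f} → f ∈ edges P → pe f ≡ posE P f
        pe-on {f} m with f ∈? edges P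
        ... | yes _  = refl
        ... | no f∉  = contradiction m f∉

        pe-off : ∀ {f} → f ∉ edges P → pe f ≡ pv (anEnd f)
        pe-off {f} f∉ with f ∈? edges P
        ... | yes m = contradiction m f∉
        ... | no _  = refl

        pe-e₁ : pe e₁ ≡ 0
        pe-e₁ = trans (pe-off e₁∉) (trans (pv-on (start-∈ P)) (posV-start P))

        -- The possible positions of an edge at `w`: that of `w`, the next one for the edge of `P`
        -- that leaves `w`, and 0 for `e₁` at `v`.
        At : ℕ → V H → Set
        At n w = n ≡ pv w ⊎ (w ∈ vertices P × n ≡ suc (pv w)) ⊎ (w ≡ v × n ≡ 0)

        pe-at : ∀ {f w} → Endpoint f w → At (pe f) w
        pe-at {f} {w} end = by (f ∈? edges P) (f ≟ e₁)
          where
          by : Dec (f ∈ edges P) → Dec (f ≡ e₁) → At (pe f) w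
          by (yes m) _ with pos-endpoint P (Path.simple path) m end
          ... | inj₁ eq = inj₁ (trans (pe-on m) (trans eq (sym (pv-on (endpoint-∈ P m end)))))
          ... | inj₂ eq =
              inj₂ (inj₁ (endpoint-∈ P m end , trans (pe-on m) (trans eq (cong suc (sym (pv-on (endpoint-∈ P m end)))))))
          by (no f∉) (yes refl) with endpoint-cases H {e₁} (joins-ends H e₁) end
          ... | inj₁ refl = inj₁ (pe-off f∉)
          ... | inj₂ refl = inj₂ (inj₂ (refl , pe-e₁))
          by (no f∉) (no f≢) =
              inj₁ (trans (pe-off f∉) (anchor-unique (off (λ { (here eq) → f≢ eq ; (there m) → f∉ m }) end) (anchored? (anEnd f)) (anchored? w)))

      ordered⇒⊥ : (Λ′ : Linkage G) (let module Λ′ = Linkage Λ′) →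
                  ψ (Λ′.φ 0F) ≡ e₁ → (∀ a → a ≢ 0F → ψ (Λ′.φ a) ∈ edges P) →
                  pe (ψ (Λ′.φ 1F)) ℕ.< pe (ψ (Λ′.φ 2F)) → pe (ψ (Λ′.φ 2F)) ℕ.< pe (ψ (Λ′.φ 3F)) → ⊥
      ordered⇒⊥ Λ′ first onP p<q q<r = not-cyclic Λ′ (level ∘ pe) lab-φ Gate gate-unique gated
        where
        module Λ′ = Linkage Λ′
        open Levels p<q q<r
        p r : ℕ
        p = pe (ψ (Λ′.φ 1F))
        r = pe (ψ (Λ′.φ 3F))

        0<p : 0 ℕ.< p
        0<p = subst (0 ℕ.<_) (sym (pe-on (onP 1F λ ()))) (posE-positive P (onP 1F λ ()))

        -- Hence positions from that of `v` on have level 3, and at `v` they meet level 0 through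
        -- `e₁`.
        r≤v : r ℕ.≤ pv v
        r≤v =
            subst₂ ℕ._≤_ (sym (pe-on (onP 3F λ ()))) (sym (pv-on (end-∈ P))) (posE-bound P (Path.simple path) (onP 3F λ ()))

        lab-φ : ∀ a → level (pe (ψ (Λ′.φ a))) ≡ a
        lab-φ 0F = level-0 (subst (ℕ._< p) (sym (trans (cong pe first) pe-e₁)) 0<p)
        lab-φ 1F = level-1 ℕₚ.≤-refl p<q
        lab-φ 2F = level-2 ℕₚ.≤-refl q<r
        lab-φ 3F = level-3 ℕₚ.≤-refl

        -- The vertex before the k-th edge of `P` has position k - 1, hence `suc`. The first three
        -- gates are the vertices at which `P` enters a branch vertex; the last one is `v`.
        Gate : Fin 4 → V H → Set
        Gate m w = (m ≡ 3F × w ≡ v) ⊎ (w ∈ vertices P × Threshold m (suc (pv w)))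

        threshold-unique : ∀ {m k l} → Threshold m k → Threshold m l → k ≡ l
        threshold-unique at-p at-p = refl
        threshold-unique at-q at-q = refl
        threshold-unique at-r at-r = refl

        gate-unique : ∀ {m w w′} → Gate m w → Gate m w′ → w ≡ w′
        gate-unique (inj₁ (refl , p)) (inj₁ (_ , q)) = trans p (sym q)
        gate-unique (inj₂ (m , t)) (inj₂ (n , t′)) =
          posV-injective P m n (trans (sym (pv-on m)) (trans (ℕₚ.suc-injective (threshold-unique t t′)) (pv-on n)))
        gate-unique (inj₁ (refl , _)) (inj₂ (_ , ()))
        gate-unique (inj₂ (_ , ())) (inj₁ (refl , _))

        Between : V H → Fin 4 → Fin 4 → Set
        Between w a b = ∃[ m ] (Gate m w × Same (a , b) (m , cyclic m))

        between-sym : ∀ {w a b} → Between w a b → Between w b a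
        between-sym (m , g , inj₁ (x , y)) = m , g , inj₂ (y , x)
        between-sym (m , g , inj₂ (x , y)) = m , g , inj₁ (y , x)

        step : ∀ {w n n′} → w ∈ vertices P → n ≡ pv w → n′ ≡ suc (pv w) → level n ≢ level n′ → Between w (level n) (level n′)
        step {w} on refl refl ne with level-step (pv w)
        ... | inj₁ eq              = contradiction eq ne
        ... | inj₂ (m , t , x , y) = m , inj₂ (on , t) , inj₁ (x , y)

        wrap : ∀ {w n n′} → w ≡ v → pv v ℕ.≤ n → n′ ≡ 0 → Between w (level n) (level n′)
        wrap refl v≤n refl = 3F , inj₁ (refl , refl) , inj₁ (level-3 (ℕₚ.≤-trans r≤v v≤n) , level-0 0<p)

        between : ∀ {w n n′} → At n w → At n′ w → level n ≢ level n′ → Between w (level n) (level n′)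
        between (inj₁ refl) (inj₁ refl) ne = contradiction refl ne
        between (inj₁ x) (inj₂ (inj₁ (on , y))) ne = step on x y ne
        between (inj₁ refl) (inj₂ (inj₂ (refl , y))) ne = wrap refl ℕₚ.≤-refl y
        between (inj₂ (inj₁ (on , x))) (inj₁ y) ne = between-sym (step on y x (≢-sym ne))
        between (inj₂ (inj₁ (_ , refl))) (inj₂ (inj₁ (_ , refl))) ne = contradiction refl ne
        between (inj₂ (inj₁ (_ , refl))) (inj₂ (inj₂ (refl , y))) ne = wrap refl (ℕₚ.n≤1+n _) y
        between (inj₂ (inj₂ (refl , x))) (inj₁ refl) ne = between-sym (wrap refl ℕₚ.≤-refl x)
        between (inj₂ (inj₂ (refl , x))) (inj₂ (inj₁ (_ , refl))) ne = between-sym (wrap refl (ℕₚ.n≤1+n _) x)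
        between (inj₂ (inj₂ (_ , refl))) (inj₂ (inj₂ (_ , refl))) ne = contradiction refl ne

        gated : ∀ {e f w} → Endpoint e w → Endpoint f w → level (pe e) ≢ level (pe f) → Between w (level (pe e)) (level (pe f))
        gated p q = between (pe-at p) (pe-at q)

      chordless⇒⊥ : ⊥
      chordless⇒⊥ = by (ℕₚ.<-cmp (n 1F) (n 2F)) (ℕₚ.<-cmp (n 2F) (n 3F)) (ℕₚ.<-cmp (n 1F) (n 3F))
        where
        n : Fin 4 → ℕ
        n a = pe (ψ (φ a))

        onP : ∀ a → a ≢ 0F → ψ (φ a) ∈ edges P
        onP a a≢0 with all-on-cycle a
        ... | here eq = contradiction (injective (ψ-injective eq)) a≢0
        ... | there m = m

        n-injective : ∀ a b → a ≢ 0F → b ≢ 0F → n a ≡ n b → a ≡ b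
        n-injective a b a≢0 b≢0 eq = injective (ψ-injective (posE-injective P (onP a a≢0) (onP b b≢0)
          (trans (sym (pe-on (onP a a≢0))) (trans eq (pe-on (onP b b≢0))))))

        -- The first place stays with `e₁`, whose position 0 lies before those of all edges of `P`.
        σ : Fin 4 → Fin 4 → Fin 4 → Fin 4 → Fin 4
        σ a b d 0F = 0F
        σ a b d 1F = a
        σ a b d 2F = b
        σ a b d 3F = d

        Perm : Fin 4 → Fin 4 → Fin 4 → Set
        Perm a b d = ∀ x y → σ a b d x ≡ σ a b d y → x ≡ y

        perm? : ∀ a b d → Dec (Perm a b d)
        perm? a b d = all? λ x → all? λ y → (σ a b d x ≟ σ a b d y) →-dec (x ≟ y)

        sorted : ∀ {a b d} → Perm a b d → n a ℕ.< n b → n b ℕ.< n d → ⊥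
        sorted {a} {b} {d} inj =
            ordered⇒⊥ (reindex (σ a b d) inj Λ) refl (λ x x≢0 → onP (σ a b d x) (λ eq → x≢0 (inj x 0F eq)))

        by : Tri (n 1F ℕ.< n 2F) (n 1F ≡ n 2F) (n 2F ℕ.< n 1F) → Tri (n 2F ℕ.< n 3F) (n 2F ≡ n 3F) (n 3F ℕ.< n 2F) →
             Tri (n 1F ℕ.< n 3F) (n 1F ≡ n 3F) (n 3F ℕ.< n 1F) → ⊥
        by (tri≈ _ eq _) _ _ = contradiction (n-injective 1F 2F (λ ()) (λ ()) eq) λ ()
        by _ (tri≈ _ eq _) _ = contradiction (n-injective 2F 3F (λ ()) (λ ()) eq) λ ()
        by _ _ (tri≈ _ eq _) = contradiction (n-injective 1F 3F (λ ()) (λ ()) eq) λ ()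
        by (tri< x _ _) (tri< y _ _) _ = sorted (from-yes (perm? 1F 2F 3F)) x y
        by (tri< x _ _) (tri> _ _ y) (tri< z _ _) = sorted (from-yes (perm? 1F 3F 2F)) z y
        by (tri< x _ _) (tri> _ _ y) (tri> _ _ z) = sorted (from-yes (perm? 3F 1F 2F)) z x
        by (tri> _ _ x) (tri< y _ _) (tri< z _ _) = sorted (from-yes (perm? 2F 1F 3F)) x z
        by (tri> _ _ x) (tri< y _ _) (tri> _ _ z) = sorted (from-yes (perm? 2F 3F 1F)) y z
        by (tri> _ _ x) (tri> _ _ y) _ = sorted (from-yes (perm? 3F 2F 1F)) y x

    cycle⇒K₄ : Model 4 G
    cycle⇒K₄ with any? (λ s → any? (λ t → (s ∈ᵥ? vertices P) ×-dec (t ∈ᵥ? vertices P) ×-dec ¬? (s ≟ t) ×-dec (c s ≟ c t)))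
    ... | yes (_ , _ , s∈ , t∈ , s≢t , eq) = chord⇒model s∈ t∈ s≢t eq
    ... | no ¬chord = ⊥-elim (Chordless.chordless⇒⊥ λ {s} {t} s∈ t∈ eq →
                        decidable-stable (s ≟ t) (λ s≢t → ¬chord (s , t , s∈ , t∈ , s≢t , eq)))

  linkage⇒K₄ : Model 4 G
  linkage⇒K₄ =
    let p , p∩ = componentOff-walk (e₁ ∷ []) bridgeless
        open Shortening (shorten p)
    in OnCycle.cycle⇒K₄ path (λ m → p∩ (fewer m , here refl))

immersion⇒model₄ : ∀ {G H} → LineRep G H → KImmersion 4 G → Model 4 G
immersion⇒model₄ {G} {H} rep I with any? (λ c → any? λ a → any? λ b → any? λ d → any? λ e → fourAt? c a b d e)
  where
  fourAt? : ∀ c a b d e → Dec (Unique (a ∷ b ∷ d ∷ e ∷ []) × All (λ f → Graph.Endpoint H f c) (a ∷ b ∷ d ∷ e ∷ []))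
  fourAt? c a b d e = allPairs? (λ x y → ¬? (x ≟ y)) _ ×-dec All.all? (λ f → Graph.endpoint? H f c) _
... | yes (_ , four) = fourAt⇒model rep four
... | no ¬four       = FindModel.linkage⇒K₄ rep (λ c four → ¬four (c , four)) (immersion⇒linkage I)

immersion⇔minor : ∀ {G} → IsLineGraph G → ∀ {t} → 1 ≤ t → t ≤ 4 → KImmersion t G ⇔ KMinor t G
immersion⇔minor {G} (H , iso) {suc m} _ (s≤s m≤3) =
  mk⇔ (λ I → model⇒minor (find m m≤3 I)) (λ M → model⇒immersion m≤3 (minor⇒model M))
  where
  rep : LineRep G H
  rep = lineRep iso

  find : ∀ m → m ≤ 3 → KImmersion (suc m) G → Model (suc m) G
  find 0 _ = immersion⇒model₁
  find 1 _ = immersion⇒model₂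
  find 2 _ = immersion⇒model₃ (LineRep.simple rep)
  find 3 _ = immersion⇒model₄ rep
  find (suc (suc (suc (suc _)))) (s≤s (s≤s (s≤s ())))

theorem1p4 : ((G : Graph) → IsLineGraph G → (t : ℕ) → 1 ≤ t → t ≤ 4 →
    (KImmersion t G ⇔ KMinor t G))
    ×
    ((t : ℕ) → 5 ≤ t →
    (∃[ G ] (IsLineGraph G × KImmersion t G × (¬ KMinor t G)))
    ×
    (∃[ G ] (IsLineGraph G × KMinor t G × (¬ KImmersion t G))))
theorem1p4 = (λ G line t → immersion⇔minor {G} line) , examples
  where
  examples : (t : ℕ) → 5 ≤ t →
             (∃[ G ] (IsLineGraph G × KImmersion t G × (¬ KMinor t G)))
             ×
             (∃[ G ] (IsLineGraph G × KMinor t G × (¬ KImmersion t G)))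
  examples (suc (suc (suc (suc (suc k))))) (s≤s (s≤s (s≤s (s≤s (s≤s _))))) = thickK₄-example k , grid-example k
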